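{- For every integer $n\ge0$, let $nov(n)$ (resp. $ov(n)$) be the sum, over all overpartitions of $n$, of the non-overlined (resp. overlined) parts. Then for all $n\ge 0$, $$(n+2)\,nov(n)\equiv (n^2+4n+3)\,ov(n)\pmod 5$$ and $$(n^2+1)\,nov(n)\equiv (4n^3-n^2-1)\,ov(n)\pmod 7.$$
   Context: An overpartition of $n$ is a partition of $n$ in which the first occurrence of each distinct part may be overlined. The sum of non-overlined parts counts each non-overlined part with multiplicity. -}

module Defs where

open import Data.Bool.Base using (Bool; true; false; if_then_else_)
open import Data.Empty using (⊥; ⊥-elim)
import Data.Integer.Base as ℤ
open import Data.Integer.Base using (ℤ)
import Data.Integer.Divisibility as ℤ
open import Data.List.Base
  using (List; []; _∷_; [_]; _++_; map; concatMap; replicate; upTo)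
open import Data.List.Membership.Propositional using (_∈_; find; lose)
open import Data.List.Membership.Propositional.Properties
  using (∈-++⁺ˡ; ∈-++⁺ʳ; ∈-++⁻; ∈-map⁺; ∈-map⁻; ∈-upTo⁺; ∈-upTo⁻;
         ∈-concatMap⁺; ∈-concatMap⁻)
open import Data.List.Properties using (map-++; ++-cancelˡ; ∷-injective)
open import Data.List.Relation.Unary.All as All using (All; []; _∷_)
import Data.List.Relation.Unary.All.Properties as All
open import Data.List.Relation.Unary.AllPairs as AllPairs using (AllPairs; []; _∷_)
import Data.List.Relation.Unary.AllPairs.Properties as AllPairs
open import Data.List.Relation.Unary.Any using (here)
open import Data.List.Relation.Unary.Linked using (Linked; []; [-]; _∷_)
open import Data.List.Relation.Unary.Unique.Propositional using (Unique)
import Data.List.Relation.Unary.Unique.Propositional.Properties as Unique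
open import Data.Nat.Base
open import Data.Nat.DivMod using (_/_; m/n*n≤m; m*n/n≡m; /-monoˡ-≤)
open import Data.Nat.Properties
open import Data.Nat.ListAction using (sum)
open import Data.Nat.ListAction.Properties using (sum-++)
open import Data.Product.Base using (∃; _×_; _,_; proj₁; proj₂)
open import Data.Sum.Base using (_⊎_; inj₁; inj₂)
open import Function.Base using (_∘_)
open import Function.Bundles using (_⇔_; mk⇔)
open import Relation.Binary.PropositionalEquality
  using (_≡_; _≢_; refl; sym; trans; cong; subst; module ≡-Reasoning)
open import Relation.Nullary.Negation.Core using (¬_)

record Part : Set where
  constructor part
  field
    size      : ℕ
    overlined : Bool

open Part public

-- Parts are listed in weakly decreasing order, so a part after the head is the first
-- occurrence of its size exactly when it is strictly smaller than its
-- predecessor; any other part must not be overlined.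
_≽_ : Part → Part → Set
p ≽ q = size q < size p ⊎ (size q ≡ size p × overlined q ≡ false)

record IsOverpartition (n : ℕ) (ps : List Part) : Set where
  constructor isOverpartition
  field
    ordered  : Linked _≽_ ps
    positive : All (λ p → 0 < size p) ps
    total    : sum (map size ps) ≡ n

-- All the parts of size s in an overpartition where s occurs suc j times,
-- b telling whether the first occurrence is overlined.
block : ℕ → Bool → ℕ → List Part
block s b j = part s b ∷ replicate j (part s false)

-- bounded m n lists the overpartitions of n into parts of size at most m;
-- starting m n b j lists those that consist of block (suc m) b j followed by
-- parts of size at most m (when the block fits into n).
bounded  : ℕ → ℕ → List (List Part)
starting : ℕ → ℕ → Bool → ℕ → List (List Part)

bounded zero    zero    = [ [] ]
bounded zero    (suc n) = []
bounded (suc m) n       =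
  bounded m n ++
  concatMap (λ j → starting m n false j ++ starting m n true j) (upTo (n / suc m))

starting m n b j = map (block (suc m) b j ++_) (bounded m (n ∸ suc j * suc m))

-- Each overpartition of n appears exactly once: overpartitions-unique and
-- ∈-overpartitions below.
overpartitions : ℕ → List (List Part)
overpartitions n = bounded n n

nonOverlinedSum : List Part → ℕ
nonOverlinedSum ps = sum (map (λ p → if overlined p then 0 else size p) ps)

overlinedSum : List Part → ℕ
overlinedSum ps = sum (map (λ p → if overlined p then size p else 0) ps)

nov : ℕ → ℕ
nov n = sum (map nonOverlinedSum (overpartitions n))

ov : ℕ → ℕ
ov n = sum (map overlinedSum (overpartitions n))

infix 4 _≡_[mod_]

_≡_[mod_] : ℤ → ℤ → ℕ → Set
a ≡ b [mod m ] = (ℤ.+ m) ℤ.∣ (a ℤ.- b)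

private
  _≼_ : List Part → ℕ → Set
  ps ≼ m = All (λ p → size p ≤ m) ps

  weaken : ∀ {m ps} → ps ≼ m → ps ≼ suc m
  weaken = All.map m≤n⇒m≤1+n

  block-size : ∀ s b j → sum (map size (block s b j)) ≡ suc j * s
  block-size s b j = cong (s +_) (go j)
    where
    go : ∀ j → sum (map size (replicate j (part s false))) ≡ j * s
    go zero    = refl
    go (suc j) = cong (s +_) (go j)

  block-++-size : ∀ s b j qs →
    sum (map size (block s b j ++ qs)) ≡ suc j * s + sum (map size qs)
  block-++-size s b j qs = begin
    sum (map size (block s b j ++ qs))                   ≡⟨ cong sum (map-++ size (block s b j) qs) ⟩
    sum (map size (block s b j) ++ map size qs)          ≡⟨ sum-++ (map size (block s b j)) _ ⟩
    sum (map size (block s b j)) + sum (map size qs)     ≡⟨ cong (_+ sum (map size qs)) (block-size s b j) ⟩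
    suc j * s + sum (map size qs)                        ∎
    where open ≡-Reasoning

  block-++-linked : ∀ {m qs} b j → qs ≼ m → Linked _≽_ qs →
                    Linked _≽_ (block (suc m) b j ++ qs)
  block-++-linked b zero    []       _  = [-]
  block-++-linked b zero    (q≤ ∷ _) qs = inj₁ (s≤s q≤) ∷ qs
  block-++-linked b (suc j) qs≤      qs =
    inj₂ (refl , refl) ∷ block-++-linked false j qs≤ qs

  block-all : ∀ {P : Part → Set} {s} b j → (∀ c → P (part s c)) → All P (block s b j)
  block-all b j Ps = Ps b ∷ All.replicate⁺ j (Ps false)

  fits⁺ : ∀ {j m n} → j < n / suc m → suc j * suc m ≤ n
  fits⁺ {j} {m} {n} j< = ≤-trans (*-monoˡ-≤ (suc m) j<) (m/n*n≤m n (suc m))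

  fits⁻ : ∀ {j m n} → suc j * suc m ≤ n → j < n / suc m
  fits⁻ {j} {m} {n} le =
    subst (_≤ n / suc m) (m*n/n≡m (suc j) (suc m)) (/-monoˡ-≤ (suc m) le)

  ∈-layer : ∀ {m n b} j {ps} → ps ∈ starting m n b j →
            ps ∈ starting m n false j ++ starting m n true j
  ∈-layer {b = false} j = ∈-++⁺ˡ
  ∈-layer {m} {n} {b = true} j = ∈-++⁺ʳ (starting m n false j)

  ∈-layer⁻ : ∀ {m n} j {ps} → ps ∈ starting m n false j ++ starting m n true j →
             ∃ λ b → ps ∈ starting m n b j
  ∈-layer⁻ {m} {n} j ps∈ with ∈-++⁻ (starting m n false j) ps∈
  ... | inj₁ p = false , p
  ... | inj₂ p = true , p

  sound : ∀ m n {ps} → ps ∈ bounded m n → IsOverpartition n ps × ps ≼ m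
  sound zero    zero    (here refl) = isOverpartition [] [] refl , []
  sound (suc m) n ps∈ with ∈-++⁻ (bounded m n) ps∈
  ... | inj₁ p = let ps-op , ps≤ = sound m n p in ps-op , weaken ps≤
  ... | inj₂ p
    with j , j∈ , q ← find (∈-concatMap⁻ _ {xs = upTo (n / suc m)} p)
    with b , r ← ∈-layer⁻ {m} {n} j q
    with qs , qs∈ , refl ← ∈-map⁻ _ r
    with isOverpartition ord pos tot , qs≤ ← sound m (n ∸ suc j * suc m) qs∈
    = isOverpartition
        (block-++-linked b j qs≤ ord)
        (All.++⁺ (block-all b j (λ _ → z<s)) pos)
        (trans (block-++-size (suc m) b j qs)
          (trans (cong (suc j * suc m +_) tot) (m+[n∸m]≡n (fits⁺ {j} (∈-upTo⁻ j∈)))))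
    , All.++⁺ (block-all b j (λ _ → ≤-refl)) (weaken qs≤)

  linked-≼ : ∀ {p ps m} → size p ≤ m → Linked _≽_ (p ∷ ps) → ps ≼ m
  linked-≼ p≤ [-] = []
  linked-≼ p≤ (inj₁ q<p ∷ l) = let q≤ = ≤-trans (<⇒≤ q<p) p≤ in q≤ ∷ linked-≼ q≤ l
  linked-≼ p≤ (inj₂ (q≡p , _) ∷ l) = let q≤ = ≤-trans (≤-reflexive q≡p) p≤ in q≤ ∷ linked-≼ q≤ l

  linked-tail : ∀ {p ps} → Linked _≽_ (p ∷ ps) → Linked _≽_ ps
  linked-tail [-]     = []
  linked-tail (_ ∷ l) = l

  split : ∀ m b ps → Linked _≽_ (part (suc m) b ∷ ps) →
          ∃ λ j → ∃ λ qs → part (suc m) b ∷ ps ≡ block (suc m) b j ++ qs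
                           × qs ≼ m × Linked _≽_ qs
  split m b []       l = 0 , [] , refl , [] , []
  split m b (q ∷ ps) (inj₁ (s≤s q≤) ∷ l) = 0 , q ∷ ps , refl , q≤ ∷ linked-≼ q≤ l , l
  split m b (q ∷ ps) (inj₂ (refl , refl) ∷ l)
    with j , qs , eq , qs≤ , qs-l ← split m false ps l
    = suc j , qs , cong (part (suc m) b ∷_) eq , qs≤ , qs-l

  complete : ∀ m n {ps} → IsOverpartition n ps → ps ≼ m → ps ∈ bounded m n
  complete zero n {[]} (isOverpartition _ _ refl) _ = here refl
  complete zero n {p ∷ ps} (isOverpartition _ (p> ∷ _) _) (p≤ ∷ _) = ⊥-elim (<⇒≱ p> p≤)
  complete (suc m) n {[]} op _ = ∈-++⁺ˡ (complete m n op [])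
  complete (suc m) n {p ∷ ps} op@(isOverpartition ord pos tot) (p≤ ∷ _)
    with m≤n⇒m<n∨m≡n p≤
  ... | inj₁ (s≤s p≤m) = ∈-++⁺ˡ (complete m n op (p≤m ∷ linked-≼ p≤m ord))
  ... | inj₂ refl
    with j , qs , eq , qs≤ , qs-l ← split m (overlined p) ps ord
    = ∈-++⁺ʳ (bounded m n)
        (∈-concatMap⁺ _ (lose (∈-upTo⁺ (fits⁻ {j} fit)) (∈-layer {m} {n} j ps∈)))
    where
    b = overlined p

    n≡ : suc j * suc m + sum (map size qs) ≡ n
    n≡ = trans (sym (block-++-size (suc m) b j qs))
               (trans (cong (sum ∘ map size) (sym eq)) tot)

    fit : suc j * suc m ≤ n
    fit = subst (suc j * suc m ≤_) n≡ (m≤m+n _ _)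

    qs-total : sum (map size qs) ≡ n ∸ suc j * suc m
    qs-total = trans (sym (m+n∸m≡n (suc j * suc m) _)) (cong (_∸ suc j * suc m) n≡)

    qs∈ : qs ∈ bounded m (n ∸ suc j * suc m)
    qs∈ = complete m _
      (isOverpartition qs-l
        (All.++⁻ʳ (block (suc m) b j) (subst (All _) eq pos)) qs-total)
      qs≤

    ps∈ : p ∷ ps ∈ starting m n b j
    ps∈ = subst (_∈ starting m n b j) (sym eq) (∈-map⁺ _ qs∈)

  replicate-++-injective : ∀ {m b} i j {qs rs} → qs ≼ m → rs ≼ m →
    replicate i (part (suc m) b) ++ qs ≡ replicate j (part (suc m) b) ++ rs → i ≡ j
  replicate-++-injective zero    zero    _ _ _ = refl
  replicate-++-injective zero    (suc j) (q≤ ∷ _) _ refl = ⊥-elim (1+n≰n q≤)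
  replicate-++-injective (suc i) zero    _ (r≤ ∷ _) refl = ⊥-elim (1+n≰n r≤)
  replicate-++-injective (suc i) (suc j) qs≤ rs≤ eq =
    cong suc (replicate-++-injective i j qs≤ rs≤ (proj₂ (∷-injective eq)))

  starting-injective : ∀ {m n b c} i j {ps} →
    ps ∈ starting m n b i → ps ∈ starting m n c j → b ≡ c × i ≡ j
  starting-injective {m} i j ps∈ ps∈′
    with qs , qs∈ , refl ← ∈-map⁻ _ ps∈
    with rs , rs∈ , eq ← ∈-map⁻ _ ps∈′
    = cong overlined (proj₁ (∷-injective eq))
    , replicate-++-injective i j (proj₂ (sound m _ qs∈)) (proj₂ (sound m _ rs∈))
        (proj₂ (∷-injective eq))

  unique : ∀ m n → Unique (bounded m n)
  unique zero    zero    = [] ∷ []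
  unique zero    (suc n) = []
  unique (suc m) n = Unique.++⁺ (unique m n)
    (Unique.concat⁺
      (All.map⁺ (All.universal layer-unique (upTo (n / suc m))))
      (AllPairs.map⁺ (AllPairs.map layers-disjoint (Unique.upTo⁺ (n / suc m)))))
    λ (p , q) → old-disjoint p q
    where
    layer : ℕ → List (List Part)
    layer j = starting m n false j ++ starting m n true j

    starting-unique : ∀ b j → Unique (starting m n b j)
    starting-unique b j = Unique.map⁺ (++-cancelˡ (block (suc m) b j) _ _) (unique m _)

    layer-unique : ∀ j → Unique (layer j)
    layer-unique j = Unique.++⁺ (starting-unique false j) (starting-unique true j)
      λ (p , q) → case-false (proj₁ (starting-injective {m} {n} j j p q))
      where
      case-false : false ≡ true → ⊥
      case-false ()

    layers-disjoint : ∀ {i j} → i ≢ j → ∀ {ps} → ¬ (ps ∈ layer i × ps ∈ layer j)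
    layers-disjoint {i} {j} i≢j (p , q) =
      i≢j (proj₂ (starting-injective {m} {n} i j
        (proj₂ (∈-layer⁻ {m} {n} i p)) (proj₂ (∈-layer⁻ {m} {n} j q))))

    old-disjoint : ∀ {ps} → ps ∈ bounded m n → ps ∈ concatMap layer (upTo (n / suc m)) → ⊥
    old-disjoint p∈ q∈
      with j , _ , q ← find (∈-concatMap⁻ layer {xs = upTo (n / suc m)} q∈)
      with b , r ← ∈-layer⁻ {m} {n} j q
      with qs , _ , refl ← ∈-map⁻ _ r
      with p≤ ∷ _ ← proj₂ (sound m n p∈)
      = 1+n≰n p≤

  parts≤total : ∀ ps → ps ≼ sum (map size ps)
  parts≤total []       = []
  parts≤total (p ∷ ps) =
    m≤m+n _ _ ∷ All.map (λ q≤ → ≤-trans q≤ (m≤n+m _ (size p))) (parts≤total ps)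

overpartitions-unique : ∀ n → Unique (overpartitions n)
overpartitions-unique n = unique n n

∈-overpartitions : ∀ {n ps} → ps ∈ overpartitions n ⇔ IsOverpartition n ps
∈-overpartitions {n} {ps} = mk⇔ (proj₁ ∘ sound n n) λ op →
  complete n n op (subst (ps ≼_) (IsOverpartition.total op) (parts≤total ps))

{-# OPTIONS --safe #-}
-- Put X_a = q^a / (1 - q^a) and D = q d/dq. Since (1 + q^a) / (1 - q^a) = 1 + 2 X_a, the
-- overpartition series P = ∏ (1 + 2 X_a) satisfies D P = 2 (s - t) P, and Σ ov(n) q^n = (s - 2t) P,
-- where s = Σ a X_a and t = Σ a X_2a; moreover nov(n) + ov(n) is n times the coefficient of q^n in P.
-- So the theorem says D² ((s - 2t) P) = D² P + 2 D P modulo 5 and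
-- 4 D³ ((s - 2t) P) = D³ P + D P modulo 7, which is a matter of knowing D s and D t.
--
-- These come from X_a X_b = X_{a+b} (1 + X_a + X_b) and D X_a = a (X_a + X_a²) alone. Expanding
-- Σ g(a, b) X_a X_b once along max(a, b) and once along a + b (Liouville's elementary method) gives
--   12 s² + 6 D s = 5 s₃ + s,   240 s s₃ + 30 D s₃ + s = 21 s₅ + 10 s₃,   s_e = Σ a^e X_a,
-- the same for t with D/2 in place of D, and, with weights depending on parities,
--   12 (s - 2t)² + (s - 2t) = s₃ + 4 t₃.
-- Modulo 5 the first identity is a differential equation for s. Modulo 7 the others determine
-- D s, D t and D t₃ in terms of s, t and t₃, and differentiating the last one yields in addition an
-- algebraic relation Q = 0; the claim is a combination of Q and D Q.
module Submission where

open import Defs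
open import Algebra.Bundles using (CommutativeRing)
import Algebra.Properties.AbelianGroup
import Algebra.Properties.CommutativeSemigroup
import Algebra.Solver.Ring
open import Algebra.Solver.Ring.AlmostCommutativeRing
  using (fromCommutativeRing; _-Raw-AlmostCommutative⟶_; Induced-equivalence)
open import Data.Bool.Base using (Bool; true; false; not; _xor_; if_then_else_)
open import Data.Bool.Properties using (not-distribˡ-xor; xor-same)
open import Data.Fin.Base using (Fin; zero; suc)
import Data.Integer.Base as ℤ
open import Data.Integer.Base using (ℤ; +_; _+_; _-_; _*_; _^_)
import Data.Integer.Divisibility.Signed as ℤ
import Data.Integer.Properties as ℤ
import Data.Integer.Solver
open import Data.List.Base
  using (List; []; _∷_; _++_; map; concatMap; replicate; upTo; applyUpTo)
open import Data.List.Membership.Propositional using (_∈_)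
open import Data.List.Properties using (map-++; map-∘; map-cong-local)
import Data.List.Relation.Unary.All as All
open import Data.Maybe.Base using (just; nothing)
import Data.Nat.Base as ℕ
open import Data.Nat.Base using (ℕ; zero; suc; z≤n; s≤s; _≤_; _<_)
import Data.Nat.Divisibility as ℕ
open import Data.Nat.DivMod using (m<n⇒m/n≡0; n/n≡1; +-distrib-/-∣ˡ)
open import Data.Nat.ListAction using (sum)
open import Data.Nat.ListAction.Properties using (sum-++)
import Data.Nat.Properties as ℕ
import Data.Nat.Solver
open import Data.Product.Base using (∃; _×_; _,_)
open import Data.Vec.Base using (Vec; lookup; []; _∷_)
open import Function.Base using (flip; _∘_)
open import Function.Bundles using (module Equivalence)
import Level
open import Level using (0ℓ)
open import Relation.Binary.Definitions using (WeaklyDecidable)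
open import Relation.Binary.PropositionalEquality as ≡ using (_≡_)
import Relation.Binary.Reasoning.Setoid
open import Relation.Nullary.Decidable.Core using (yes; no)

-- The obstacle is to avoid infinite sums and division. For fixed n everything happens among series
-- modulo p and q^(n+1): there X_a = 0 for a > n, so all sums are finite, and D survives because it
-- multiplies each coefficient by its degree. The equation X_a = q^a (1 + X_a) replaces the
-- quotient, and the denominators 6 and 30 of power sums stay as integer factors until the prime
-- makes them invertible. Liouville's method closes up for this reason: the two expansions of Σ g(a,
-- b) X_a X_b differ, on X_a X_m with a < m, by g(a, m) - g(a, m - a). The weights g make this a
-- constant times a sum of products u(a) v(m), so these terms reassemble into products of sums such
-- as s_e. The rest lies on the diagonal, in terms a^e X_a², which D supplies. The primes enter as
-- follows: 5 removes s₃ from the first identity and 7 removes s₅ from the second. Hence the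
-- polynomials in s, t, P modulo 5, and those in s, t, t₃, P modulo 7, are closed under D, and each
-- claim becomes a finite polynomial computation.

private
  module ℕS = Data.Nat.Solver.+-*-Solver
  module ℤS = Data.Integer.Solver.+-*-Solver

-- Finite sums over intervals, squares and antidiagonals.

module Sums {c ℓ} (R : CommutativeRing c ℓ) where

  open CommutativeRing R renaming (_+_ to _⊕_; _*_ to _⊛_)
  open Relation.Binary.Reasoning.Setoid setoid
  open Algebra.Properties.CommutativeSemigroup
    (CommutativeRing.+-commutativeSemigroup R) using (interchange)

  ∑ : ℕ → (ℕ → Carrier) → Carrier
  ∑ zero    f = 0#
  ∑ (suc n) f = ∑ n f ⊕ f n

  -- ∑ of h i j over i + j ≡ k.
  diag : ℕ → (ℕ → ℕ → Carrier) → Carrier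
  diag zero    h = h 0 0
  diag (suc k) h = h 0 (suc k) ⊕ diag k (h ∘ suc)

  ∑-cong : ∀ n {f g} → (∀ i → f i ≈ g i) → ∑ n f ≈ ∑ n g
  ∑-cong zero    f≈g = refl
  ∑-cong (suc n) f≈g = +-cong (∑-cong n f≈g) (f≈g n)

  ∑-zero : ∀ n {f} → (∀ i → f i ≈ 0#) → ∑ n f ≈ 0#
  ∑-zero zero    f≈0 = refl
  ∑-zero (suc n) f≈0 = trans (+-cong (∑-zero n f≈0) (f≈0 n)) (+-identityˡ 0#)

  ∑-+ : ∀ n f g → ∑ n (λ i → f i ⊕ g i) ≈ ∑ n f ⊕ ∑ n g
  ∑-+ zero    f g = sym (+-identityˡ 0#)
  ∑-+ (suc n) f g = trans (+-congʳ (∑-+ n f g)) (interchange _ _ _ _)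

  ∑-*ˡ : ∀ n x f → ∑ n (λ i → x ⊛ f i) ≈ x ⊛ ∑ n f
  ∑-*ˡ zero    x f = sym (zeroʳ x)
  ∑-*ˡ (suc n) x f = trans (+-congʳ (∑-*ˡ n x f)) (sym (distribˡ x _ _))

  ∑-*ʳ : ∀ n f x → ∑ n (λ i → f i ⊛ x) ≈ ∑ n f ⊛ x
  ∑-*ʳ n f x = begin
    ∑ n (λ i → f i ⊛ x) ≈⟨ ∑-cong n (λ i → *-comm (f i) x) ⟩
    ∑ n (λ i → x ⊛ f i) ≈⟨ ∑-*ˡ n x f ⟩
    x ⊛ ∑ n f           ≈⟨ *-comm x _ ⟩
    ∑ n f ⊛ x           ∎

  ∑-product : ∀ n f g → ∑ n f ⊛ ∑ n g ≈ ∑ n (λ i → ∑ n (λ j → f i ⊛ g j))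
  ∑-product n f g =
    trans (sym (∑-*ʳ n f _)) (∑-cong n λ i → sym (∑-*ˡ n (f i) g))

  ∑-head : ∀ n f → ∑ (suc n) f ≈ f 0 ⊕ ∑ n (f ∘ suc)
  ∑-head zero    f = +-comm 0# (f 0)
  ∑-head (suc n) f = trans (+-congʳ (∑-head n f)) (+-assoc _ _ _)

  ∑-extend : ∀ {n m} f → n ≤ m → (∀ i → n ≤ i → f i ≈ 0#) → ∑ m f ≈ ∑ n f
  ∑-extend {m = m} f z≤n       f≈0 = ∑-zero m λ i → f≈0 i z≤n
  ∑-extend f (s≤s {n} {m} n≤m) f≈0 = begin
    ∑ (suc m) f           ≈⟨ ∑-head m f ⟩
    f 0 ⊕ ∑ m (f ∘ suc)   ≈⟨ +-congˡ (∑-extend (f ∘ suc) n≤m λ i n≤i → f≈0 (suc i) (s≤s n≤i)) ⟩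
    f 0 ⊕ ∑ n (f ∘ suc)   ≈⟨ ∑-head n f ⟨
    ∑ (suc n) f           ∎

  ∑-pairs : ∀ n f → ∑ (n ℕ.+ n) f ≈ ∑ n (λ i → f (i ℕ.+ i) ⊕ f (suc (i ℕ.+ i)))
  ∑-pairs zero    f = refl
  ∑-pairs (suc n) f rewrite ℕ.+-suc n n =
    trans (+-assoc _ _ _) (+-congʳ (∑-pairs n f))

  diag-cong : ∀ k {h h′} → (∀ i j → i ℕ.+ j ≡ k → h i j ≈ h′ i j) → diag k h ≈ diag k h′
  diag-cong zero    eq = eq 0 0 ≡.refl
  diag-cong (suc k) eq =
    +-cong (eq 0 (suc k) ≡.refl) (diag-cong k λ i j i+j → eq (suc i) j (≡.cong suc i+j))

  diag-+ : ∀ k h h′ → diag k (λ i j → h i j ⊕ h′ i j) ≈ diag k h ⊕ diag k h′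
  diag-+ zero    h h′ = refl
  diag-+ (suc k) h h′ = trans (+-congˡ (diag-+ k (h ∘ suc) (h′ ∘ suc))) (interchange _ _ _ _)

  diag-*ˡ : ∀ k x h → diag k (λ i j → x ⊛ h i j) ≈ x ⊛ diag k h
  diag-*ˡ zero    x h = refl
  diag-*ˡ (suc k) x h = trans (+-congˡ (diag-*ˡ k x (h ∘ suc))) (sym (distribˡ x _ _))

  diag-last : ∀ k h → diag (suc k) h ≈ diag k (λ i j → h i (suc j)) ⊕ h (suc k) 0
  diag-last zero    h = refl
  diag-last (suc k) h = trans (+-congˡ (diag-last k (h ∘ suc))) (sym (+-assoc _ _ _))

  diag-swap : ∀ k h → diag k h ≈ diag k (flip h)
  diag-swap zero    h = refl
  diag-swap (suc k) h = begin
    h 0 (suc k) ⊕ diag k (h ∘ suc)               ≈⟨ +-comm _ _ ⟩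
    diag k (h ∘ suc) ⊕ h 0 (suc k)               ≈⟨ +-congʳ (diag-swap k (h ∘ suc)) ⟩
    diag k (λ i j → h (suc j) i) ⊕ h 0 (suc k)   ≈⟨ diag-last k (flip h) ⟨
    diag (suc k) (flip h)                        ∎

  diag-fst : ∀ k f → diag k (λ i _ → f i) ≈ ∑ (suc k) f
  diag-fst zero    f = sym (+-identityˡ (f 0))
  diag-fst (suc k) f = trans (+-congˡ (diag-fst k (f ∘ suc))) (sym (∑-head (suc k) f))

  -- The step is demanded on the antidiagonal only, so that `G` may depend on `k`: the partial sums
  -- below involve both a and the fixed total m.
  diag-telescope : ∀ k (h : ℕ → ℕ → Carrier) (G : ℕ → Carrier) → (∀ i j → i ℕ.+ j ≡ k → G (suc i) ≈ G i ⊕ h i j) →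
                   G (suc k) ≈ G 0 ⊕ diag k h
  diag-telescope zero    h G step = step 0 0 ≡.refl
  diag-telescope (suc k) h G step = begin
    G (suc (suc k))                             ≈⟨ diag-telescope k (h ∘ suc) (G ∘ suc)
                                                     (λ i j i+j → step (suc i) j (≡.cong suc i+j)) ⟩
    G 1 ⊕ diag k (h ∘ suc)                      ≈⟨ +-congʳ (step 0 (suc k) ≡.refl) ⟩
    G 0 ⊕ h 0 (suc k) ⊕ diag k (h ∘ suc)        ≈⟨ +-assoc _ _ _ ⟩
    G 0 ⊕ diag (suc k) h                        ∎

  -- Enlarging the square by one adds a last column, a last row and a corner, which together form
  -- one hook.
  square-by-hooks : ∀ n (h : ℕ → ℕ → Carrier) →
    ∑ n (λ i → ∑ n (h i)) ≈
    ∑ n (λ m → h m m) ⊕ ∑ n (λ m → ∑ m (λ i → h i m ⊕ h m i))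
  square-by-hooks zero    h = sym (+-identityˡ 0#)
  square-by-hooks (suc n) h = begin
    ∑ n (λ i → ∑ n (h i) ⊕ h i n) ⊕ (∑ n (h n) ⊕ h n n)
      ≈⟨ +-congʳ (∑-+ n _ _) ⟩
    ∑ n (λ i → ∑ n (h i)) ⊕ ∑ n (λ i → h i n) ⊕ (∑ n (h n) ⊕ h n n)
      ≈⟨ +-cong (+-congʳ (square-by-hooks n h)) (+-comm _ _) ⟩
    (∑ n (λ m → h m m) ⊕ ∑ n (λ m → ∑ m (λ i → h i m ⊕ h m i))) ⊕ ∑ n (λ i → h i n) ⊕ (h n n ⊕ ∑ n (h n))
      ≈⟨ +-congʳ (+-assoc _ _ _) ⟩
    ∑ n (λ m → h m m) ⊕ (∑ n (λ m → ∑ m (λ i → h i m ⊕ h m i)) ⊕ ∑ n (λ i → h i n)) ⊕ (h n n ⊕ ∑ n (h n))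
      ≈⟨ interchange _ _ _ _ ⟩
    (∑ n (λ m → h m m) ⊕ h n n) ⊕ (∑ n (λ m → ∑ m (λ i → h i m ⊕ h m i)) ⊕ ∑ n (λ i → h i n) ⊕ ∑ n (h n))
      ≈⟨ +-congˡ (trans (+-assoc _ _ _) (+-congˡ (sym (∑-+ n _ _)))) ⟩
    ∑ (suc n) (λ m → h m m) ⊕ ∑ (suc n) (λ m → ∑ m (λ i → h i m ⊕ h m i)) ∎

  -- The first `n` antidiagonals lie wholly inside the rectangle and all other entries vanish. The
  -- sides are independent because removing the first row shortens only one of them.
  rectangle-by-diagonals : ∀ {n r c} (h : ℕ → ℕ → Carrier) → n ≤ r → n ≤ c →
    (∀ i j → n ≤ i ℕ.+ j → h i j ≈ 0#) →
    ∑ r (λ i → ∑ c (h i)) ≈ ∑ n (λ k → diag k h)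
  rectangle-by-diagonals {r = r} {c} h z≤n n≤c h≈0 =
    ∑-zero r λ i → ∑-zero c λ j → h≈0 i j z≤n
  rectangle-by-diagonals {c = c} h (s≤s {n} {r} n≤r) n≤c h≈0 = begin
    ∑ (suc r) (λ i → ∑ c (h i))
      ≈⟨ ∑-head r _ ⟩
    ∑ c (h 0) ⊕ ∑ r (λ i → ∑ c (h (suc i)))
      ≈⟨ +-cong (∑-extend (h 0) n≤c (h≈0 0))
                (rectangle-by-diagonals (h ∘ suc) n≤r (ℕ.<⇒≤ n≤c) λ i j n≤ → h≈0 (suc i) j (s≤s n≤)) ⟩
    ∑ (suc n) (h 0) ⊕ ∑ n (λ k → diag k (h ∘ suc))
      ≈⟨ +-congʳ (∑-head n (h 0)) ⟩
    h 0 0 ⊕ ∑ n (λ k → h 0 (suc k)) ⊕ ∑ n (λ k → diag k (h ∘ suc))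
      ≈⟨ +-assoc _ _ _ ⟩
    h 0 0 ⊕ (∑ n (λ k → h 0 (suc k)) ⊕ ∑ n (λ k → diag k (h ∘ suc)))
      ≈⟨ +-congˡ (∑-+ n _ _) ⟨
    h 0 0 ⊕ ∑ n (λ k → diag (suc k) h)
      ≈⟨ ∑-head n (λ k → diag k h) ⟨
    ∑ (suc n) (λ k → diag k h) ∎

  -- Column m becomes antidiagonal m - 1. Column 0 is empty, so the antidiagonals reach column `n`,
  -- one beyond the triangle, which therefore has to vanish.
  triangle-by-diagonals : ∀ n (h : ℕ → ℕ → Carrier) → (∀ i → h i n ≈ 0#) →
    ∑ n (λ m → ∑ m (λ i → h i m)) ≈ ∑ n (λ k → diag k (λ i j → h i (suc (i ℕ.+ j))))
  triangle-by-diagonals n h h≈0 = begin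
    ∑ n (λ m → ∑ m (λ i → h i m))
      ≈⟨ trans (+-congˡ (∑-zero n h≈0)) (+-identityʳ _) ⟨
    ∑ (suc n) (λ m → ∑ m (λ i → h i m))
      ≈⟨ trans (∑-head n _) (+-identityˡ _) ⟩
    ∑ n (λ k → ∑ (suc k) (λ i → h i (suc k)))
      ≈⟨ ∑-cong n (λ k → sym (diag-fst k λ i → h i (suc k))) ⟩
    ∑ n (λ k → diag k (λ i _ → h i (suc k)))
      ≈⟨ ∑-cong n (λ k → diag-cong k λ i j i+j → reflexive (≡.cong (h i ∘ suc) (≡.sym i+j))) ⟩
    ∑ n (λ k → diag k (λ i j → h i (suc (i ℕ.+ j)))) ∎

-- Integer weights and their sums over a + b = m.

-- Indices are shifted by one: index i stands for the part i + 1.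
power : ℕ → ℕ → ℤ
power e i = (+ suc i) ^ e

oddPart : ℕ → Bool
oddPart zero    = true
oddPart (suc i) = not (oddPart i)

oddPart-+ : ∀ i j → oddPart (suc (i ℕ.+ j)) ≡ oddPart i xor oddPart j
oddPart-+ zero    j = ≡.refl
oddPart-+ (suc i) j =
  ≡.trans (≡.cong not (oddPart-+ i j)) (not-distribˡ-xor (oddPart i) (oddPart j))

infixr 6 _when_

_when_ : ℤ → Bool → ℤ
a when b = if b then a else + 0

oddOnly evenOnly : (ℕ → ℤ) → ℕ → ℤ
oddOnly  u i = u i when oddPart i
evenOnly u i = u i when not (oddPart i)

module _ where

  open ℤS using (Polynomial; solve; con; var; :-_; _:+_; _:*_; _:-_; _:^_; _:=_; ⟦_⟧)

  open Sums ℤ.+-*-commutativeRing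
    using (diag; diag-telescope; diag-*ˡ; diag-+; diag-swap; diag-cong)

  -- The factor `l` clears the denominator of a power sum, so that the closed form `G` has integer
  -- values.
  diag-closed : ∀ l k (h : ℕ → ℕ → ℤ) (G : ℕ → ℤ) → G 0 ≡ + 0 →
    (∀ i j → i ℕ.+ j ≡ k → G (suc i) ≡ G i + l * h i j) → l * diag k h ≡ G (suc k)
  diag-closed l k h G G0≡0 step = begin
    l * diag k h                    ≡⟨ diag-*ˡ k l h ⟨
    diag k (λ i j → l * h i j)      ≡⟨ ℤ.+-identityˡ _ ⟨
    + 0 + diag k (λ i j → l * h i j) ≡⟨ ≡.cong (_+ _) G0≡0 ⟨
    G 0 + diag k (λ i j → l * h i j) ≡⟨ diag-telescope k _ G step ⟨
    G (suc k)                        ∎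
    where open ≡.≡-Reasoning

  -- At (a, m) and (a, m - a) the values are m² + a² + am and m² + a² - am. They differ by 2am, and
  -- their squares differ by 4am (a² + m²).
  quadratic : ℤ → ℤ → ℤ
  quadratic a b = a ^ 2 + a * b + b ^ 2

  -- Substituting b = m - a leaves a sum over 1 ≤ a ≤ m - 1; both indices are shifted, so m is `k` +
  -- 2.
  6∑quadratic : ∀ k → + 6 * diag k (λ i j → quadratic (+ suc i) (+ suc j)) ≡
    + 5 * power 3 (suc k) + (ℤ.- + 6 * power 2 (suc k) + power 1 (suc k))
  6∑quadratic k = ≡.trans
    (diag-closed (+ 6) k _ (λ i → G (+ i) (+ suc (suc k)))
      (solve 1 (λ m → ∑ₚ (con (+ 0)) m := con (+ 0)) ≡.refl (+ suc (suc k)))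
      λ { i j ≡.refl → solve 2 (λ i j →
        let a = con (+ 1) :+ i; b = con (+ 1) :+ j; m = con (+ 2) :+ (i :+ j) in
        ∑ₚ a m := ∑ₚ i m :+ con (+ 6) :* (a :^ 2 :+ a :* b :+ b :^ 2)) ≡.refl (+ i) (+ j) })
    (solve 1 (λ k → let m = con (+ 2) :+ k in
      ∑ₚ (con (+ 1) :+ k) m :=
      con (+ 5) :* m :^ 3 :+ (con (ℤ.- + 6) :* m :^ 2 :+ m :^ 1)) ≡.refl (+ k))
    where
    -- 6 times the sum of a² - a m + m² over 1 ≤ a ≤ i.
    ∑ₚ : ∀ {n} → Polynomial n → Polynomial n → Polynomial n
    ∑ₚ i m = i :* (i :+ con (+ 1)) :* (con (+ 2) :* i :+ con (+ 1))
      :- con (+ 3) :* m :* i :* (i :+ con (+ 1)) :+ con (+ 6) :* m :^ 2 :* i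

    G : ℤ → ℤ → ℤ
    G i m = ⟦ ∑ₚ (var zero) (var (suc zero)) ⟧ (i ∷ m ∷ [])

  30∑quadratic² : ∀ k → + 30 * diag k (λ i j → quadratic (+ suc i) (+ suc j) ^ 2) ≡
    + 21 * power 5 (suc k) + (ℤ.- + 30 * power 4 (suc k) + (+ 10 * power 3 (suc k) + ℤ.- + 1 * power 1 (suc k)))
  30∑quadratic² k = ≡.trans
    (diag-closed (+ 30) k _ (λ i → G (+ i) (+ suc (suc k)))
      (solve 1 (λ m → ∑ₚ (con (+ 0)) m := con (+ 0)) ≡.refl (+ suc (suc k)))
      λ { i j ≡.refl → solve 2 (λ i j →
        let a = con (+ 1) :+ i; b = con (+ 1) :+ j; m = con (+ 2) :+ (i :+ j) in
        ∑ₚ a m := ∑ₚ i m :+ con (+ 30) :* (a :^ 2 :+ a :* b :+ b :^ 2) :^ 2) ≡.refl (+ i) (+ j) })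
    (solve 1 (λ k → let m = con (+ 2) :+ k in
      ∑ₚ (con (+ 1) :+ k) m :=
      con (+ 21) :* m :^ 5 :+ (con (ℤ.- + 30) :* m :^ 4 :+ (con (+ 10) :* m :^ 3 :+ con (ℤ.- + 1) :* m :^ 1)))
      ≡.refl (+ k))
    where
    -- 30 times the sum of (a² - a m + m²)² over 1 ≤ a ≤ i.
    ∑ₚ : ∀ {n} → Polynomial n → Polynomial n → Polynomial n
    ∑ₚ i m = i :* (i :+ con (+ 1)) :* (con (+ 2) :* i :+ con (+ 1)) :* (con (+ 3) :* i :^ 2 :+ con (+ 3) :* i :- con (+ 1))
      :- con (+ 15) :* m :* i :^ 2 :* (i :+ con (+ 1)) :^ 2 :+ con (+ 15) :* m :^ 2 :* i :* (i :+ con (+ 1)) :* (con (+ 2) :* i :+ con (+ 1))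
      :- con (+ 30) :* m :^ 3 :* i :* (i :+ con (+ 1)) :+ con (+ 30) :* m :^ 4 :* i

    G : ℤ → ℤ → ℤ
    G i m = ⟦ ∑ₚ (var zero) (var (suc zero)) ⟧ (i ∷ m ∷ [])

  -- Built so that g(a, m) - g(a, m - a) is 4am if a and m are odd, namely (a + m)² - (m - a)², and
  -- 0 in all other cases.
  parityWeight : Bool → Bool → ℤ → ℤ → ℤ
  parityWeight true  true  a b = (a + b) ^ 2
  parityWeight true  false a b = b ^ 2
  parityWeight false true  a b = a ^ 2
  parityWeight false false a b = + 0

  parityWeight-sym : ∀ o o′ a b → parityWeight o o′ a b ≡ parityWeight o′ o b a
  parityWeight-sym true  true  a b = ≡.cong (_^ 2) (ℤ.+-comm a b)
  parityWeight-sym true  false a b = ≡.refl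
  parityWeight-sym false true  a b = ≡.refl
  parityWeight-sym false false a b = ≡.refl

  parityWeight-shift : ∀ o o′ i j → let a = + suc i; m = + suc (suc (i ℕ.+ j)) in
    parityWeight o (o xor o′) a m ≡
    parityWeight o o′ a (+ suc j) + + 4 * ((a ^ 1 when o) * (m ^ 1 when (o xor o′)))
  parityWeight-shift true true i j = solve 2 (λ i j →
    let a = con (+ 1) :+ i; b = con (+ 1) :+ j; m = con (+ 2) :+ (i :+ j) in
    m :^ 2 := (a :+ b) :^ 2 :+ con (+ 4) :* (a :^ 1 :* con (+ 0))) ≡.refl (+ i) (+ j)
  parityWeight-shift true false i j = solve 2 (λ i j →
    let a = con (+ 1) :+ i; b = con (+ 1) :+ j; m = con (+ 2) :+ (i :+ j) in
    (a :+ m) :^ 2 := b :^ 2 :+ con (+ 4) :* (a :^ 1 :* m :^ 1)) ≡.refl (+ i) (+ j)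
  parityWeight-shift false true i j = ≡.sym (ℤ.+-identityʳ _)
  parityWeight-shift false false i j = ≡.refl

  -- For odd a this is (2a)² = 4a². Hence no X_a² survives, and the resulting identity contains no
  -- derivative.
  parityWeight-diagonal : ∀ o a → parityWeight o o a a - + 4 * ((a ^ 1 when o) * (a ^ 1 when o)) ≡ + 0
  parityWeight-diagonal true  = solve 1 (λ a →
    (a :+ a) :^ 2 :- con (+ 4) :* (a :^ 1 :* a :^ 1) := con (+ 0)) ≡.refl
  parityWeight-diagonal false a = ≡.refl

  2∑odd : ∀ k → + 2 * diag k (λ i _ → + 1 when oddPart i) ≡
                (if oddPart (suc k) then + suc k else + suc (suc k))
  2∑odd k = diag-closed (+ 2) k _ (λ i → G i (oddPart i)) ≡.refl λ i j _ → step i (oddPart i)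
    where
    -- Twice the number of odd a among 1, ..., `i`, where the flag tells whether `i` + 1 is odd.
    G : ℕ → Bool → ℤ
    G i o = if o then + i else + suc i

    step : ∀ i o → G (suc i) (not o) ≡ G i o + + 2 * (+ 1 when o)
    step i true  = ≡.cong +_ (ℕ.+-comm 2 i)
    step i false = ≡.sym (ℤ.+-identityʳ (+ suc i))

  6∑even² : ∀ k → + 6 * diag k (λ i _ → evenOnly (power 2) i) ≡
    (if oddPart (suc k) then + suc k * + suc (suc k) * (+ 3 + + k) else + k * + suc k * + suc (suc k))
  6∑even² k = ≡.trans
    (diag-closed (+ 6) k _ (λ i → G i (oddPart i)) ≡.refl λ i j _ → step i (oddPart i))
    (last (oddPart (suc k)))
    where
    -- 6 times the sum of the even squares up to `i`², the flag again being the parity of `i` + 1.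
    G : ℕ → Bool → ℤ
    G i o = if o then + i * + suc i * (+ 2 + + i) else (+ i - + 1) * + i * + suc i

    step : ∀ i o → G (suc i) (not o) ≡ G i o + + 6 * (power 2 i when not o)
    step i true  = solve 1 (λ i → (con (+ 1) :+ i :- con (+ 1)) :* (con (+ 1) :+ i) :* (con (+ 2) :+ i) :=
      i :* (con (+ 1) :+ i) :* (con (+ 2) :+ i) :+ con (+ 6) :* con (+ 0)) ≡.refl (+ i)
    step i false = solve 1 (λ i → (con (+ 1) :+ i) :* (con (+ 2) :+ i) :* (con (+ 3) :+ i) :=
      (i :- con (+ 1)) :* i :* (con (+ 1) :+ i) :+ con (+ 6) :* (con (+ 1) :+ i) :^ 2) ≡.refl (+ i)

    last : ∀ o → G (suc k) o ≡
      (if o then + suc k * + suc (suc k) * (+ 3 + + k) else + k * + suc k * + suc (suc k))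
    last true  = ≡.refl
    last false = ≡.refl

  -- For odd m exactly one of a and b is even and the weight is its square, which gives twice the
  -- sum of the even squares below m. For even m the weight is m² if a is odd and 0 if a is even, so
  -- it remains to count the odd a.
  6∑parityWeight : ∀ k →
    + 6 * diag k (λ i j → parityWeight (oddPart i) (oddPart j) (+ suc i) (+ suc j)) ≡
    + 2 * power 3 (suc k) + (evenOnly (power 3) (suc k) + ℤ.- + 2 * oddOnly (power 1) (suc k))
  6∑parityWeight k with oddPart (suc k) in odd | 2∑odd k | 6∑even² k
  ... | true  | _    | even² = begin
    + 6 * diag k w
      ≡⟨ ≡.cong (_*_ (+ 6)) (diag-cong k λ { i j ≡.refl →
           odd-total i j (oddPart i) (oddPart j) (≡.trans (≡.sym (oddPart-+ i j)) odd) }) ⟩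
    + 6 * diag k (λ i j → evenOnly (power 2) i + evenOnly (power 2) j)
      ≡⟨ ≡.cong (_*_ (+ 6)) (≡.trans (diag-+ k _ _) (≡.cong (_+_ S) (≡.sym (diag-swap k _)))) ⟩
    + 6 * (S + S)
      ≡⟨ ℤ.*-distribˡ-+ (+ 6) S S ⟩
    + 6 * S + + 6 * S
      ≡⟨ ≡.cong₂ _+_ even² even² ⟩
    + suc k * + suc (suc k) * (+ 3 + + k) + + suc k * + suc (suc k) * (+ 3 + + k)
      ≡⟨ solve 1 (λ k → let m = con (+ 2) :+ k; c = (con (+ 1) :+ k) :* m :* (con (+ 3) :+ k) in
           c :+ c := con (+ 2) :* m :^ 3 :+ (con (+ 0) :+ con (ℤ.- + 2) :* m :^ 1)) ≡.refl (+ k) ⟩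
    + 2 * power 3 (suc k) + (+ 0 + ℤ.- + 2 * power 1 (suc k)) ∎
    where
    open ≡.≡-Reasoning
    w : ℕ → ℕ → ℤ
    w i j = parityWeight (oddPart i) (oddPart j) (+ suc i) (+ suc j)

    S = diag k (λ i _ → evenOnly (power 2) i)

    odd-total : ∀ i j o o′ → o xor o′ ≡ true → parityWeight o o′ (+ suc i) (+ suc j) ≡
      (power 2 i when not o) + (power 2 j when not o′)
    odd-total i j true  false _ = ≡.sym (ℤ.+-identityˡ _)
    odd-total i j false true  _ = ≡.sym (ℤ.+-identityʳ _)
  ... | false | odds | _     = begin
    + 6 * diag k w
      ≡⟨ ≡.cong (_*_ (+ 6)) (diag-cong k λ { i j ≡.refl →
           even-total i j (oddPart i) (oddPart j) (≡.trans (≡.sym (oddPart-+ i j)) odd) }) ⟩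
    + 6 * diag k (λ i _ → power 2 (suc k) * (+ 1 when oddPart i))
      ≡⟨ ≡.cong (_*_ (+ 6)) (diag-*ˡ k (power 2 (suc k)) (λ i _ → + 1 when oddPart i)) ⟩
    + 6 * (power 2 (suc k) * S)
      ≡⟨ solve 2 (λ p S → con (+ 6) :* (p :* S) := con (+ 3) :* p :* (con (+ 2) :* S)) ≡.refl (power 2 (suc k)) S ⟩
    + 3 * power 2 (suc k) * (+ 2 * S)
      ≡⟨ ≡.cong (_*_ (+ 3 * power 2 (suc k))) odds ⟩
    + 3 * power 2 (suc k) * + suc (suc k)
      ≡⟨ solve 1 (λ m → con (+ 3) :* m :^ 2 :* m :=
           con (+ 2) :* m :^ 3 :+ (m :^ 3 :+ con (ℤ.- + 2) :* con (+ 0))) ≡.refl (+ suc (suc k)) ⟩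
    + 2 * power 3 (suc k) + (power 3 (suc k) + ℤ.- + 2 * + 0) ∎
    where
    open ≡.≡-Reasoning
    w : ℕ → ℕ → ℤ
    w i j = parityWeight (oddPart i) (oddPart j) (+ suc i) (+ suc j)

    S = diag k (λ i _ → + 1 when oddPart i)

    even-total : ∀ i j o o′ → o xor o′ ≡ false → parityWeight o o′ (+ suc i) (+ suc j) ≡
      power 2 (suc (i ℕ.+ j)) * (+ 1 when o)
    even-total i j true  true  _ = solve 2 (λ i j →
      ((con (+ 1) :+ i) :+ (con (+ 1) :+ j)) :^ 2 := (con (+ 2) :+ (i :+ j)) :^ 2 :* con (+ 1)) ≡.refl (+ i) (+ j)
    even-total i j false false _ = ≡.sym (ℤ.*-zeroʳ (power 2 (suc (i ℕ.+ j))))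

  quadratic-sym : ∀ a b → quadratic a b ≡ quadratic b a
  quadratic-sym = solve 2 (λ a b →
    a :^ 2 :+ a :* b :+ b :^ 2 := b :^ 2 :+ b :* a :+ a :^ 2) ≡.refl

  quadratic-shift : ∀ i j → let a = + suc i; m = + suc (suc (i ℕ.+ j)) in
    quadratic a m ≡ quadratic a (+ suc j) + + 2 * (a ^ 1 * m ^ 1)
  quadratic-shift i j = solve 2 (λ i j →
    let a = con (+ 1) :+ i; b = con (+ 1) :+ j; m = con (+ 2) :+ (i :+ j) in
    a :^ 2 :+ a :* m :+ m :^ 2 :=
    a :^ 2 :+ a :* b :+ b :^ 2 :+ con (+ 2) :* (a :^ 1 :* m :^ 1)) ≡.refl (+ i) (+ j)

  quadratic²-shift : ∀ i j → let a = + suc i; m = + suc (suc (i ℕ.+ j)) in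
    quadratic a m ^ 2 ≡ quadratic a (+ suc j) ^ 2 + + 4 * (a ^ 1 * m ^ 3 + a ^ 3 * m ^ 1)
  quadratic²-shift i j = solve 2 (λ i j →
    let a = con (+ 1) :+ i; b = con (+ 1) :+ j; m = con (+ 2) :+ (i :+ j) in
    (a :^ 2 :+ a :* m :+ m :^ 2) :^ 2 :=
    (a :^ 2 :+ a :* b :+ b :^ 2) :^ 2 :+ con (+ 4) :* (a :^ 1 :* m :^ 3 :+ a :^ 3 :* m :^ 1))
    ≡.refl (+ i) (+ j)

  quadratic-diagonal : ∀ a → + 6 * a ^ 2 ≡ + 6 * (quadratic a a - + 2 * (a ^ 1 * a ^ 1))
  quadratic-diagonal = solve 1 (λ a → con (+ 6) :* a :^ 2 :=
    con (+ 6) :* ((a :^ 2 :+ a :* a :+ a :^ 2) :- con (+ 2) :* (a :^ 1 :* a :^ 1))) ≡.refl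

  quadratic²-diagonal : ∀ a →
    + 30 * a ^ 4 ≡ + 30 * (quadratic a a ^ 2 - + 4 * (a ^ 1 * a ^ 3 + a ^ 3 * a ^ 1))
  quadratic²-diagonal = solve 1 (λ a → con (+ 30) :* a :^ 4 :=
    con (+ 30) :* ((a :^ 2 :+ a :* a :+ a :^ 2) :^ 2
      :- con (+ 4) :* (a :^ 1 :* a :^ 3 :+ a :^ 3 :* a :^ 1))) ≡.refl

  power₁-double : ∀ i → power 1 (suc (i ℕ.+ i)) ≡ + 2 * power 1 i
  power₁-double i = solve 1 (λ i →
    (con (+ 2) :+ (i :+ i)) :^ 1 := con (+ 2) :* (con (+ 1) :+ i) :^ 1) ≡.refl (+ i)

  power₃-double : ∀ i → power 3 (suc (i ℕ.+ i)) ≡ + 8 * power 3 i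
  power₃-double i = solve 1 (λ i →
    (con (+ 2) :+ (i :+ i)) :^ 3 := con (+ 8) :* (con (+ 1) :+ i) :^ 3) ≡.refl (+ i)

-- Derivations and polynomial identities with integer coefficients.

module IntegerCoefficients {r ℓ} (R : CommutativeRing r ℓ)
  (ι : ℤ.+-*-rawRing -Raw-AlmostCommutative⟶ fromCommutativeRing R) where

  open CommutativeRing R hiding (zero) renaming (_+_ to _⊕_; _*_ to _⊛_; _-_ to _⊖_)
  open Algebra.Properties.AbelianGroup +-abelianGroup using (∙-cancelʳ; inverseˡ-unique; x∙y⁻¹≈ε⇒x≈y)
  open Relation.Binary.Reasoning.Setoid setoid
  open Sums R
  open Sums ℤ.+-*-commutativeRing using () renaming (diag to diagℤ)
  open _-Raw-AlmostCommutative⟶_ ι public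

  record IsDerivation (D : Carrier → Carrier) : Set (r Level.⊔ ℓ) where
    field
      D-cong : ∀ {x y} → x ≈ y → D x ≈ D y
      D-+    : ∀ x y → D (x ⊕ y) ≈ D x ⊕ D y
      D-*    : ∀ x y → D (x ⊛ y) ≈ D x ⊛ y ⊕ x ⊛ D y
      D-ι    : ∀ a → D ⟦ a ⟧ ≈ 0#

    D-0 : D 0# ≈ 0#
    D-0 = trans (D-cong (sym 0-homo)) (D-ι (+ 0))

    D-neg : ∀ x → D (- x) ≈ - D x
    D-neg x = inverseˡ-unique _ _ (begin
      D (- x) ⊕ D x ≈⟨ D-+ _ _ ⟨
      D (- x ⊕ x)   ≈⟨ D-cong (-‿inverseˡ x) ⟩
      D 0#          ≈⟨ D-0 ⟩
      0#            ∎)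

    D-ι* : ∀ a x → D (⟦ a ⟧ ⊛ x) ≈ ⟦ a ⟧ ⊛ D x
    D-ι* a x = begin
      D (⟦ a ⟧ ⊛ x)              ≈⟨ D-* _ _ ⟩
      D ⟦ a ⟧ ⊛ x ⊕ ⟦ a ⟧ ⊛ D x  ≈⟨ +-congʳ (trans (*-congʳ (D-ι a)) (zeroˡ x)) ⟩
      0# ⊕ ⟦ a ⟧ ⊛ D x           ≈⟨ +-identityˡ _ ⟩
      ⟦ a ⟧ ⊛ D x                ∎

    D-∑ : ∀ n f → D (∑ n f) ≈ ∑ n (D ∘ f)
    D-∑ zero    f = D-0
    D-∑ (suc n) f = trans (D-+ _ _) (+-congʳ (D-∑ n f))

  -- Taking p = 0 decides equality of the coefficients themselves.
  module Solver (p : ℕ) (p≈0 : ⟦ + p ⟧ ≈ 0#) where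

    decide : WeaklyDecidable (Induced-equivalence ι)
    decide a b with (+ p) ℤ.∣? (a - b)
    ... | no  _               = nothing
    ... | yes (ℤ.divides q e) = just (begin
      ⟦ a ⟧                   ≡⟨ ≡.cong ⟦_⟧ (≡.trans (≡.sym (Algebra.Properties.AbelianGroup.//-rightDividesˡ ℤ.+-0-abelianGroup b a)) (≡.cong (_+ b) e)) ⟩
      ⟦ q * + p + b ⟧         ≈⟨ trans (+-homo _ _) (+-congʳ (*-homo _ _)) ⟩
      ⟦ q ⟧ ⊛ ⟦ + p ⟧ ⊕ ⟦ b ⟧ ≈⟨ +-congʳ (trans (*-congˡ p≈0) (zeroʳ _)) ⟩
      0# ⊕ ⟦ b ⟧              ≈⟨ +-identityˡ _ ⟩
      ⟦ b ⟧                   ∎)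

    open Algebra.Solver.Ring ℤ.+-*-rawRing (fromCommutativeRing R) ι decide public
      renaming (⟦_⟧ to ⟦_⟧ₑ)

    -- Normal forms need not reduce coefficients modulo p, but they do drop multiples of p.
    prove-difference : ∀ {n} ρ (e f : Polynomial n) → ⟦ e :- f ⟧↓ ρ ≈ 0# → ⟦ e ⟧ₑ ρ ≈ ⟦ f ⟧ₑ ρ
    prove-difference ρ e f eq = x∙y⁻¹≈ε⇒x≈y _ _ (trans (sym (correct (e :- f) ρ)) eq)

    -- Leibniz' rule on solver syntax, from prescribed derivatives `δ` of the variables. Iterated
    -- derivatives thus become polynomials that can be normalised.
    ∂ : ∀ {n} → (Fin n → Polynomial n) → Polynomial n → Polynomial n
    ∂ δ (op [+] e f)   = ∂ δ e :+ ∂ δ f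
    ∂ δ (op [*] e f)   = ∂ δ e :* f :+ e :* ∂ δ f
    ∂ δ (con a)        = con (+ 0)
    ∂ δ (var i)        = δ i
    ∂ δ (e :^ zero)    = con (+ 0)
    ∂ δ (e :^ (suc n)) = ∂ δ e :* e :^ n :+ e :* ∂ δ (e :^ n)
    ∂ δ (:- e)         = :- ∂ δ e

    module _ {D} (isD : IsDerivation D) {n} (δ : Fin n → Polynomial n) (ρ : Vec Carrier n)
             (D-var : ∀ i → D (lookup ρ i) ≈ ⟦ δ i ⟧ₑ ρ) where

      open IsDerivation isD

      ∂-correct : ∀ e → D (⟦ e ⟧ₑ ρ) ≈ ⟦ ∂ δ e ⟧ₑ ρ
      ∂-correct (op [+] e f) = trans (D-+ _ _) (+-cong (∂-correct e) (∂-correct f))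
      ∂-correct (op [*] e f) =
        trans (D-* _ _) (+-cong (*-congʳ (∂-correct e)) (*-congˡ (∂-correct f)))
      ∂-correct (con a)      = trans (D-ι a) (sym 0-homo)
      ∂-correct (var i)      = D-var i
      ∂-correct (e :^ zero)  = trans (trans (D-cong (sym 1-homo)) (D-ι (+ 1))) (sym 0-homo)
      ∂-correct (e :^ suc n) =
        trans (D-* _ _) (+-cong (*-congʳ (∂-correct e)) (*-congˡ (∂-correct (e :^ n))))
      ∂-correct (:- e)       = trans (D-neg _) (-‿cong (∂-correct e))

  ≈⇒-≈0 : ∀ {x y} → x ≈ y → x ⊖ y ≈ 0#
  ≈⇒-≈0 {y = y} x≈y = trans (+-congʳ x≈y) (-‿inverseʳ y)

  -- Liouville's method.

  -- The relation below holds for x i = q^(i+1) / (1 - q^(i+1)).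
  module Lambert (x : ℕ → Carrier)
    (x-* : ∀ i j → x i ⊛ x j ≈ x (suc (i ℕ.+ j)) ⊛ (1# ⊕ x i ⊕ x j))
    (N : ℕ) (x-vanishes : ∀ i → N ≤ i → x i ≈ 0#) where

    open Solver 0 0-homo using (solve; con; :-_; _:+_; _:*_; _:-_; _:=_)

    private
      two : Carrier
      two = ⟦ + 2 ⟧

    square : (ℕ → ℕ → Carrier) → Carrier
    square f = ∑ N λ i → ∑ N λ j → f i j ⊛ (x i ⊛ x j)

    diagonal : (ℕ → ℕ → Carrier) → Carrier
    diagonal f = ∑ N λ m → f m m ⊛ (x m ⊛ x m)

    private
      -- The shape in which both expansions meet: X_a X_m for a < m, with m written as a + b.
      hooks : (ℕ → ℕ → Carrier) → Carrier
      hooks f = ∑ N λ k → diag k λ i j → f i j ⊛ (x i ⊛ x (suc (i ℕ.+ j)))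

      vanishesʳ : ∀ y z {i} → N ≤ i → y ⊛ (z ⊛ x i) ≈ 0#
      vanishesʳ y z N≤i =
        trans (*-congˡ (trans (*-congˡ (x-vanishes _ N≤i)) (zeroʳ z))) (zeroʳ y)

      ∑-diag-cong : ∀ {f g} → (∀ i j → f i j ≈ g i j) →
                    ∑ N (λ k → diag k f) ≈ ∑ N (λ k → diag k g)
      ∑-diag-cong f≈g = ∑-cong N λ k → diag-cong k λ i j _ → f≈g i j

      ∑-diag-+ : ∀ f g → ∑ N (λ k → diag k (λ i j → f i j ⊕ g i j)) ≈
                 ∑ N (λ k → diag k f) ⊕ ∑ N (λ k → diag k g)
      ∑-diag-+ f g = trans (∑-cong N λ k → diag-+ k f g) (∑-+ N _ _)

      ∑-diag-* : ∀ y f → ∑ N (λ k → diag k (λ i j → y ⊛ f i j)) ≈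
                 y ⊛ ∑ N (λ k → diag k f)
      ∑-diag-* y f = trans (∑-cong N λ k → diag-*ˡ k y f) (∑-*ˡ N y _)

      -- Expansion along max(a, b). Symmetry of `f` merges the two legs of a hook, whence the factor
      -- two.
      square-hooks : ∀ f → (∀ i j → f i j ≈ f j i) →
        square f ≈ diagonal f ⊕ two ⊛ hooks (λ i j → f i (suc (i ℕ.+ j)))
      square-hooks f f-sym = begin
        square f
          ≈⟨ square-by-hooks N h ⟩
        diagonal f ⊕ ∑ N (λ m → ∑ m λ i → h i m ⊕ h m i)
          ≈⟨ +-congˡ (∑-cong N λ m → ∑-cong m λ i → double i m) ⟩
        diagonal f ⊕ ∑ N (λ m → ∑ m λ i → two ⊛ h i m)
          ≈⟨ +-congˡ (triangle-by-diagonals N (λ i m → two ⊛ h i m) λ i →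
               trans (*-congˡ (vanishesʳ _ _ ℕ.≤-refl)) (zeroʳ _)) ⟩
        diagonal f ⊕ ∑ N (λ k → diag k λ i j → two ⊛ h i (suc (i ℕ.+ j)))
          ≈⟨ +-congˡ (∑-diag-* two _) ⟩
        diagonal f ⊕ two ⊛ hooks (λ i j → f i (suc (i ℕ.+ j))) ∎
        where
        h : ℕ → ℕ → Carrier
        h i j = f i j ⊛ (x i ⊛ x j)

        double : ∀ i m → h i m ⊕ h m i ≈ two ⊛ h i m
        double i m = trans (+-congˡ (*-cong (f-sym m i) (*-comm _ _)))
          (solve 1 (λ y → y :+ y := con (+ 2) :* y) refl (h i m))

      -- Expansion along a + b. By `x-*` every term contains X_{a+b}, which kills the terms with a +
      -- b beyond `N`; the summand 1 yields the single sum, and X_a and X_b yield equal hooks by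
      -- symmetry of `g`.
      square-diagonals : ∀ g → (∀ i j → g i j ≈ g j i) →
        square g ≈ ∑ N (λ k → diag k g ⊛ x (suc k)) ⊕ two ⊛ hooks g
      square-diagonals g g-sym = begin
        square g
          ≈⟨ rectangle-by-diagonals _ ℕ.≤-refl ℕ.≤-refl vanish ⟩
        ∑ N (λ k → diag k λ i j → g i j ⊛ (x i ⊛ x j))
          ≈⟨ ∑-cong N on-diagonal ⟩
        ∑ N (λ k → diag k g ⊛ x (suc k) ⊕ two ⊛ diag k h)
          ≈⟨ ∑-+ N _ _ ⟩
        ∑ N (λ k → diag k g ⊛ x (suc k)) ⊕ ∑ N (λ k → two ⊛ diag k h)
          ≈⟨ +-congˡ (∑-*ˡ N two _) ⟩
        ∑ N (λ k → diag k g ⊛ x (suc k)) ⊕ two ⊛ hooks g ∎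
        where
        h : ℕ → ℕ → Carrier
        h i j = g i j ⊛ (x i ⊛ x (suc (i ℕ.+ j)))

        vanish : ∀ i j → N ≤ i ℕ.+ j → g i j ⊛ (x i ⊛ x j) ≈ 0#
        vanish i j N≤ = begin
          g i j ⊛ (x i ⊛ x j) ≈⟨ *-congˡ (x-* i j) ⟩
          g i j ⊛ (x (suc (i ℕ.+ j)) ⊛ (1# ⊕ x i ⊕ x j)) ≈⟨ *-congˡ (*-comm _ _) ⟩
          g i j ⊛ ((1# ⊕ x i ⊕ x j) ⊛ x (suc (i ℕ.+ j))) ≈⟨ vanishesʳ _ _ (ℕ.m≤n⇒m≤1+n N≤) ⟩
          0# ∎

        expand : ∀ g xi xj xk →
          g ⊛ (xk ⊛ (⟦ + 1 ⟧ ⊕ xi ⊕ xj)) ≈ xk ⊛ g ⊕ (g ⊛ (xi ⊛ xk) ⊕ g ⊛ (xj ⊛ xk))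
        expand = solve 4 (λ g xi xj xk →
          g :* (xk :* (con (+ 1) :+ xi :+ xj)) :=
          xk :* g :+ (g :* (xi :* xk) :+ g :* (xj :* xk))) refl

        on-diagonal : ∀ k → diag k (λ i j → g i j ⊛ (x i ⊛ x j)) ≈
                            diag k g ⊛ x (suc k) ⊕ two ⊛ diag k h
        on-diagonal k = begin
          diag k (λ i j → g i j ⊛ (x i ⊛ x j))
            ≈⟨ (diag-cong k λ i j i+j → begin
                 g i j ⊛ (x i ⊛ x j)
                   ≈⟨ *-congˡ (trans (x-* i j) (*-congˡ (+-congʳ (+-congʳ (sym 1-homo))))) ⟩
                 g i j ⊛ (x (suc (i ℕ.+ j)) ⊛ (⟦ + 1 ⟧ ⊕ x i ⊕ x j))
                   ≈⟨ expand _ _ _ _ ⟩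
                 x (suc (i ℕ.+ j)) ⊛ g i j ⊕ (h i j ⊕ g i j ⊛ (x j ⊛ x (suc (i ℕ.+ j))))
                   ≈⟨ +-cong (*-congʳ (reflexive (≡.cong (x ∘ suc) i+j)))
                             (+-congˡ (*-cong (g-sym i j)
                               (*-congˡ (reflexive (≡.cong (x ∘ suc) (ℕ.+-comm i j)))))) ⟩
                 x (suc k) ⊛ g i j ⊕ (h i j ⊕ h j i) ∎) ⟩
          diag k (λ i j → x (suc k) ⊛ g i j ⊕ (h i j ⊕ h j i))
            ≈⟨ trans (diag-+ k _ _) (+-cong (diag-*ˡ k _ g) (diag-+ k h (flip h))) ⟩
          x (suc k) ⊛ diag k g ⊕ (diag k h ⊕ diag k (flip h))
            ≈⟨ +-cong (*-comm _ _) (+-congˡ (sym (diag-swap k h))) ⟩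
          diag k g ⊛ x (suc k) ⊕ (diag k h ⊕ diag k h)
            ≈⟨ +-congˡ (solve 1 (λ y → y :+ y := con (+ 2) :* y) refl _) ⟩
          diag k g ⊛ x (suc k) ⊕ two ⊛ diag k h ∎

    -- Compare the two expansions of square g.
    liouville : ∀ κ f g → (∀ i j → f i j ≈ f j i) → (∀ i j → g i j ≈ g j i) →
      (∀ i j → g i (suc (i ℕ.+ j)) ≈ g i j ⊕ κ ⊛ f i (suc (i ℕ.+ j))) →
      diagonal g ⊕ κ ⊛ square f ≈ ∑ N (λ k → diag k g ⊛ x (suc k)) ⊕ κ ⊛ diagonal f
    liouville κ f g f-sym g-sym eq = begin
      diagonal g ⊕ κ ⊛ square f
        ≈⟨ +-congˡ (*-congˡ (square-hooks f f-sym)) ⟩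
      diagonal g ⊕ κ ⊛ (diagonal f ⊕ two ⊛ F)
        ≈⟨ solve 4 (λ dg κ df F → dg :+ κ :* (df :+ con (+ 2) :* F) :=
                                  dg :+ con (+ 2) :* (κ :* F) :+ κ :* df) refl _ _ _ _ ⟩
      diagonal g ⊕ two ⊛ (κ ⊛ F) ⊕ κ ⊛ diagonal f
        ≈⟨ +-congʳ (∙-cancelʳ (two ⊛ hooks g) _ _ balance) ⟩
      ∑ N (λ k → diag k g ⊛ x (suc k)) ⊕ κ ⊛ diagonal f ∎
      where
      F = hooks (λ i j → f i (suc (i ℕ.+ j)))
      G = hooks (λ i j → g i (suc (i ℕ.+ j)))

      -- Here the hypothesis on `g` enters: `hooks g` then occurs in both expansions and cancels,
      -- while `F` is the off-diagonal half of `square f`.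
      G≈ : G ≈ hooks g ⊕ κ ⊛ F
      G≈ = begin
        G
          ≈⟨ ∑-diag-cong (λ i j → trans (*-congʳ (eq i j))
               (solve 4 (λ g κ f y → (g :+ κ :* f) :* y := g :* y :+ κ :* (f :* y)) refl _ _ _ _)) ⟩
        ∑ N (λ k → diag k λ i j → g i j ⊛ (x i ⊛ x (suc (i ℕ.+ j)))
                     ⊕ κ ⊛ (f i (suc (i ℕ.+ j)) ⊛ (x i ⊛ x (suc (i ℕ.+ j)))))
          ≈⟨ trans (∑-diag-+ _ _) (+-congˡ (∑-diag-* κ _)) ⟩
        hooks g ⊕ κ ⊛ F ∎

      balance : diagonal g ⊕ two ⊛ (κ ⊛ F) ⊕ two ⊛ hooks g ≈
                ∑ N (λ k → diag k g ⊛ x (suc k)) ⊕ two ⊛ hooks g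
      balance = begin
        diagonal g ⊕ two ⊛ (κ ⊛ F) ⊕ two ⊛ hooks g
          ≈⟨ solve 4 (λ dg κ F hg → dg :+ con (+ 2) :* (κ :* F) :+ con (+ 2) :* hg :=
                                    dg :+ con (+ 2) :* (hg :+ κ :* F)) refl _ _ _ _ ⟩
        diagonal g ⊕ two ⊛ (hooks g ⊕ κ ⊛ F) ≈⟨ +-congˡ (*-congˡ G≈) ⟨
        diagonal g ⊕ two ⊛ G                 ≈⟨ square-hooks g g-sym ⟨
        square g                             ≈⟨ square-diagonals g g-sym ⟩
        ∑ N (λ k → diag k g ⊛ x (suc k)) ⊕ two ⊛ hooks g ∎

    -- Sums over a + b = m start at m = 2. The term m = 1 may be added since `c 0` vanishes, and the
    -- surplus last term vanishes with `x N`.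
    ∑-diagonals : ∀ l (c : ℕ → Carrier) (g : ℕ → ℕ → Carrier) → c 0 ≈ 0# → (∀ k → l ⊛ diag k g ≈ c (suc k)) →
      l ⊛ ∑ N (λ k → diag k g ⊛ x (suc k)) ≈ ∑ N (λ m → c m ⊛ x m)
    ∑-diagonals l c g c0≈0 l*diag = begin
      l ⊛ ∑ N (λ k → diag k g ⊛ x (suc k))
        ≈⟨ ∑-*ˡ N l _ ⟨
      ∑ N (λ k → l ⊛ (diag k g ⊛ x (suc k)))
        ≈⟨ ∑-cong N (λ k → trans (sym (*-assoc _ _ _)) (*-congʳ (l*diag k))) ⟩
      ∑ N (λ k → c (suc k) ⊛ x (suc k))
        ≈⟨ trans (+-congʳ (trans (*-congʳ c0≈0) (zeroˡ _))) (+-identityˡ _) ⟨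
      c 0 ⊛ x 0 ⊕ ∑ N (λ k → c (suc k) ⊛ x (suc k))
        ≈⟨ ∑-head N _ ⟨
      ∑ N (λ m → c m ⊛ x m) ⊕ c N ⊛ x N
        ≈⟨ trans (+-congˡ (trans (*-congˡ (x-vanishes N ℕ.≤-refl)) (zeroʳ _))) (+-identityʳ _) ⟩
      ∑ N (λ m → c m ⊛ x m) ∎

    moment moment₂ : (ℕ → ℤ) → Carrier
    moment  u = ∑ N λ m → ⟦ u m ⟧ ⊛ x m
    moment₂ u = ∑ N λ m → ⟦ u m ⟧ ⊛ (x m ⊛ x m)

    private
      weigh : (ℕ → Carrier) → (ℕ → ℤ) → Carrier
      weigh y u = ∑ N λ m → ⟦ u m ⟧ ⊛ y m

      weigh-cong : ∀ y {u v} → (∀ m → u m ≡ v m) → weigh y u ≈ weigh y v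
      weigh-cong y u≡v = ∑-cong N λ m → *-congʳ (reflexive (≡.cong ⟦_⟧ (u≡v m)))

      weigh-+ : ∀ y u v → weigh y (λ m → u m + v m) ≈ weigh y u ⊕ weigh y v
      weigh-+ y u v = trans
        (∑-cong N λ m → trans (*-congʳ (+-homo (u m) (v m))) (distribʳ _ _ _))
        (∑-+ N _ _)

      weigh-* : ∀ y a u → weigh y (λ m → a * u m) ≈ ⟦ a ⟧ ⊛ weigh y u
      weigh-* y a u = trans
        (∑-cong N λ m → trans (*-congʳ (*-homo a (u m))) (*-assoc _ _ _))
        (∑-*ˡ N _ _)

    moment-cong : ∀ {u v} → (∀ m → u m ≡ v m) → moment u ≈ moment v
    moment-cong = weigh-cong x

    moment₂-cong : ∀ {u v} → (∀ m → u m ≡ v m) → moment₂ u ≈ moment₂ v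
    moment₂-cong = weigh-cong (λ m → x m ⊛ x m)

    moment-+ : ∀ u v → moment (λ m → u m + v m) ≈ moment u ⊕ moment v
    moment-+ = weigh-+ x

    moment-* : ∀ a u → moment (λ m → a * u m) ≈ ⟦ a ⟧ ⊛ moment u
    moment-* = weigh-* x

    moment₂-* : ∀ a u → moment₂ (λ m → a * u m) ≈ ⟦ a ⟧ ⊛ moment₂ u
    moment₂-* = weigh-* (λ m → x m ⊛ x m)

    square-product : ∀ u v → square (λ i j → ⟦ u i * v j ⟧) ≈ moment u ⊛ moment v
    square-product u v = trans
      (∑-cong N λ i → ∑-cong N λ j → trans (*-congʳ (*-homo (u i) (v j)))
        (solve 4 (λ u v x y → (u :* v) :* (x :* y) := (u :* x) :* (v :* y)) refl _ _ _ _))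
      (sym (∑-product N _ _))

    square-+ : ∀ (f g : ℕ → ℕ → ℤ) → square (λ i j → ⟦ f i j + g i j ⟧) ≈
               square (λ i j → ⟦ f i j ⟧) ⊕ square (λ i j → ⟦ g i j ⟧)
    square-+ f g = trans
      (∑-cong N λ i → trans
        (∑-cong N λ j → trans (*-congʳ (+-homo (f i j) (g i j))) (distribʳ _ _ _))
        (∑-+ N _ _))
      (∑-+ N _ _)

    private
      diag-ι : ∀ k g → diag k (λ i j → ⟦ g i j ⟧) ≈ ⟦ diagℤ k g ⟧
      diag-ι zero    g = refl
      diag-ι (suc k) g = trans (+-congˡ (diag-ι k (g ∘ suc))) (sym (+-homo _ _))

    -- For integer weights the diagonals of `g` and `f` merge into one `moment₂`. The factor `l`
    -- makes the antidiagonal sums of `g` equal to the integral closed form `c`.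
    liouvilleℤ : ∀ l κ (f g : ℕ → ℕ → ℤ) (c : ℕ → ℤ) →
      (∀ i j → f i j ≡ f j i) → (∀ i j → g i j ≡ g j i) →
      (∀ i j → g i (suc (i ℕ.+ j)) ≡ g i j + κ * f i (suc (i ℕ.+ j))) →
      c 0 ≡ + 0 → (∀ k → l * diagℤ k g ≡ c (suc k)) →
      ⟦ l * κ ⟧ ⊛ square (λ i j → ⟦ f i j ⟧) ⊕ moment₂ (λ m → l * (g m m - κ * f m m)) ≈
      moment c
    liouvilleℤ l κ f g c f-sym g-sym eq c0≡0 l*diag = begin
      ⟦ l * κ ⟧ ⊛ S ⊕ moment₂ (λ m → l * (g m m - κ * f m m))
        ≈⟨ +-cong (*-congʳ (*-homo l κ)) (trans (moment₂-* l _) (*-congˡ split)) ⟩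
      ⟦ l ⟧ ⊛ ⟦ κ ⟧ ⊛ S ⊕ ⟦ l ⟧ ⊛ (dg ⊖ ⟦ κ ⟧ ⊛ df)
        ≈⟨ solve 5 (λ l κ S dg df → l :* κ :* S :+ l :* (dg :- κ :* df) :=
                                    l :* (dg :+ κ :* S) :- l :* (κ :* df)) refl _ _ _ _ _ ⟩
      ⟦ l ⟧ ⊛ (dg ⊕ ⟦ κ ⟧ ⊛ S) ⊖ ⟦ l ⟧ ⊛ (⟦ κ ⟧ ⊛ df)
        ≈⟨ +-congʳ (*-congˡ (liouville ⟦ κ ⟧ _ _ (λ i j → lift (f-sym i j)) (λ i j → lift (g-sym i j))
             λ i j → trans (lift (eq i j)) (trans (+-homo _ _) (+-congˡ (*-homo _ _))))) ⟩
      ⟦ l ⟧ ⊛ (C ⊕ ⟦ κ ⟧ ⊛ df) ⊖ ⟦ l ⟧ ⊛ (⟦ κ ⟧ ⊛ df)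
        ≈⟨ solve 3 (λ l C z → l :* (C :+ z) :- l :* z := l :* C) refl _ _ _ ⟩
      ⟦ l ⟧ ⊛ C
        ≈⟨ ∑-diagonals ⟦ l ⟧ (λ m → ⟦ c m ⟧) _ (trans (lift c0≡0) 0-homo)
             (λ k → trans (*-congˡ (diag-ι k g)) (trans (sym (*-homo _ _)) (lift (l*diag k)))) ⟩
      moment c ∎
      where
      S = square (λ i j → ⟦ f i j ⟧)
      C = ∑ N (λ k → diag k (λ i j → ⟦ g i j ⟧) ⊛ x (suc k))
      dg = diagonal (λ i j → ⟦ g i j ⟧)
      df = diagonal (λ i j → ⟦ f i j ⟧)

      lift : ∀ {a b} → a ≡ b → ⟦ a ⟧ ≈ ⟦ b ⟧
      lift a≡b = reflexive (≡.cong ⟦_⟧ a≡b)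

      split : moment₂ (λ m → g m m - κ * f m m) ≈ dg ⊖ ⟦ κ ⟧ ⊛ df
      split = begin
        moment₂ (λ m → g m m - κ * f m m)
          ≈⟨ weigh-cong _ (λ m → ≡.cong (_+_ (g m m)) (ℤ.neg-distribˡ-* κ (f m m))) ⟩
        moment₂ (λ m → g m m + ℤ.- κ * f m m)
          ≈⟨ trans (weigh-+ _ _ _) (+-congˡ (moment₂-* _ _)) ⟩
        dg ⊕ ⟦ ℤ.- κ ⟧ ⊛ df
          ≈⟨ +-congˡ (*-congʳ (-‿homo κ)) ⟩
        dg ⊕ - ⟦ κ ⟧ ⊛ df
          ≈⟨ solve 3 (λ κ dg df → dg :+ (:- κ) :* df := dg :- κ :* df) refl _ _ _ ⟩
        dg ⊖ ⟦ κ ⟧ ⊛ df ∎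

    moment-linear : ∀ a u b v → moment (λ m → a * u m + b * v m) ≈
                    ⟦ a ⟧ ⊛ moment u ⊕ ⟦ b ⟧ ⊛ moment v
    moment-linear a u b v =
      trans (moment-+ _ _) (+-cong (moment-* a u) (moment-* b v))

    -- The extra 6 `moment (power 2)` cancels the term -6m² of the power sum and completes the
    -- diagonal a² X_a² to a² (X_a + X_a²), the derivative of a X_a.
    convolution₁₁ : ⟦ + 12 ⟧ ⊛ (moment (power 1) ⊛ moment (power 1))
        ⊕ ⟦ + 6 ⟧ ⊛ (moment (power 2) ⊕ moment₂ (power 2)) ≈
      ⟦ + 5 ⟧ ⊛ moment (power 3) ⊕ moment (power 1)
    convolution₁₁ = begin
      ⟦ + 12 ⟧ ⊛ (s ⊛ s) ⊕ ⟦ + 6 ⟧ ⊛ (moment (power 2) ⊕ moment₂ (power 2))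
        ≈⟨ solve 3 (λ a b c → a :+ con (+ 6) :* (b :+ c) := (a :+ con (+ 6) :* c) :+ con (+ 6) :* b) refl _ _ _ ⟩
      (⟦ + 12 ⟧ ⊛ (s ⊛ s) ⊕ ⟦ + 6 ⟧ ⊛ moment₂ (power 2)) ⊕ ⟦ + 6 ⟧ ⊛ moment (power 2)
        ≈⟨ +-congʳ (+-cong (*-congˡ (sym (square-product (power 1) (power 1))))
             (trans (sym (moment₂-* (+ 6) (power 2))) (moment₂-cong λ m → quadratic-diagonal (+ suc m)))) ⟩
      (⟦ + 12 ⟧ ⊛ square (λ i j → ⟦ power 1 i * power 1 j ⟧)
        ⊕ moment₂ (λ m → + 6 * (quadratic (+ suc m) (+ suc m) - + 2 * (power 1 m * power 1 m))))
        ⊕ ⟦ + 6 ⟧ ⊛ moment (power 2)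
        ≈⟨ +-congʳ (liouvilleℤ (+ 6) (+ 2) _ _
             (λ k → + 5 * power 3 k + (ℤ.- + 6 * power 2 k + power 1 k))
             (λ i j → ℤ.*-comm (power 1 i) (power 1 j)) g-sym shift ≡.refl 6∑quadratic) ⟩
      moment (λ k → + 5 * power 3 k + (ℤ.- + 6 * power 2 k + power 1 k)) ⊕ ⟦ + 6 ⟧ ⊛ moment (power 2)
        ≈⟨ +-congʳ (trans (moment-+ _ _) (+-cong (moment-* _ _) (trans (moment-+ _ _) (+-congʳ (moment-* _ _))))) ⟩
      (⟦ + 5 ⟧ ⊛ moment (power 3) ⊕ (⟦ ℤ.- + 6 ⟧ ⊛ moment (power 2) ⊕ s)) ⊕ ⟦ + 6 ⟧ ⊛ moment (power 2)
        ≈⟨ solve 3 (λ a b c → (a :+ (con (ℤ.- + 6) :* b :+ c)) :+ con (+ 6) :* b := a :+ c) refl _ _ _ ⟩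
      ⟦ + 5 ⟧ ⊛ moment (power 3) ⊕ s ∎
      where
      s = moment (power 1)

      g-sym : ∀ i j → quadratic (+ suc i) (+ suc j) ≡ quadratic (+ suc j) (+ suc i)
      g-sym i j = quadratic-sym (+ suc i) (+ suc j)

      shift : ∀ i j → quadratic (+ suc i) (+ suc (suc (i ℕ.+ j))) ≡
        quadratic (+ suc i) (+ suc j) + + 2 * (power 1 i * power 1 (suc (i ℕ.+ j)))
      shift = quadratic-shift

    -- The symmetrised weight `f` produces the product of the two moments twice, hence 240 = 30 · 4
    -- · 2. The term -30m⁴ completes the diagonal to a derivative as in `convolution₁₁`.
    convolution₁₃ : ⟦ + 240 ⟧ ⊛ (moment (power 1) ⊛ moment (power 3))
        ⊕ ⟦ + 30 ⟧ ⊛ (moment (power 4) ⊕ moment₂ (power 4)) ⊕ moment (power 1) ≈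
      ⟦ + 21 ⟧ ⊛ moment (power 5) ⊕ ⟦ + 10 ⟧ ⊛ moment (power 3)
    convolution₁₃ = begin
      ⟦ + 240 ⟧ ⊛ (s ⊛ s₃) ⊕ ⟦ + 30 ⟧ ⊛ (moment (power 4) ⊕ moment₂ (power 4)) ⊕ s
        ≈⟨ solve 5 (λ s s₃ b c d → con (+ 240) :* (s :* s₃) :+ con (+ 30) :* (b :+ c) :+ d :=
             (con (+ 120) :* (s :* s₃ :+ s₃ :* s) :+ con (+ 30) :* c) :+ (con (+ 30) :* b :+ d))
             refl _ _ _ _ _ ⟩
      (⟦ + 120 ⟧ ⊛ (s ⊛ s₃ ⊕ s₃ ⊛ s) ⊕ ⟦ + 30 ⟧ ⊛ moment₂ (power 4)) ⊕ (⟦ + 30 ⟧ ⊛ moment (power 4) ⊕ s)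
        ≈⟨ +-congʳ (+-cong (*-congˡ (sym (trans (square-+ _ _) (+-cong (square-product (power 1) (power 3))
                                                                         (square-product (power 3) (power 1))))))
             (trans (sym (moment₂-* (+ 30) (power 4))) (moment₂-cong λ m → quadratic²-diagonal (+ suc m)))) ⟩
      (⟦ + 120 ⟧ ⊛ square (λ i j → ⟦ f i j ⟧)
        ⊕ moment₂ (λ m → + 30 * (quadratic (+ suc m) (+ suc m) ^ 2 - + 4 * f m m)))
        ⊕ (⟦ + 30 ⟧ ⊛ moment (power 4) ⊕ s)
        ≈⟨ +-congʳ (liouvilleℤ (+ 30) (+ 4) f _ c f-sym
             (λ i j → ≡.cong (_^ 2) (quadratic-sym (+ suc i) (+ suc j))) quadratic²-shift ≡.refl 30∑quadratic²) ⟩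
      moment c ⊕ (⟦ + 30 ⟧ ⊛ moment (power 4) ⊕ s)
        ≈⟨ +-congʳ (trans (moment-+ _ _) (+-cong (moment-* _ _)
             (trans (moment-+ _ _) (+-cong (moment-* _ _) (moment-linear _ _ _ _))))) ⟩
      (⟦ + 21 ⟧ ⊛ moment (power 5) ⊕ (⟦ ℤ.- + 30 ⟧ ⊛ moment (power 4) ⊕
        (⟦ + 10 ⟧ ⊛ s₃ ⊕ ⟦ ℤ.- + 1 ⟧ ⊛ s))) ⊕ (⟦ + 30 ⟧ ⊛ moment (power 4) ⊕ s)
        ≈⟨ solve 4 (λ a b d e → (a :+ (con (ℤ.- + 30) :* b :+ (d :+ con (ℤ.- + 1) :* e))) :+
             (con (+ 30) :* b :+ e) := a :+ d) refl _ _ _ _ ⟩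
      ⟦ + 21 ⟧ ⊛ moment (power 5) ⊕ ⟦ + 10 ⟧ ⊛ s₃ ∎
      where
      s = moment (power 1)
      s₃ = moment (power 3)

      f : ℕ → ℕ → ℤ
      f i j = power 1 i * power 3 j + power 3 i * power 1 j

      f-sym : ∀ i j → f i j ≡ f j i
      f-sym i j = ≡.trans (ℤ.+-comm (power 1 i * power 3 j) (power 3 i * power 1 j))
        (≡.cong₂ _+_ (ℤ.*-comm (power 3 i) (power 1 j)) (ℤ.*-comm (power 1 i) (power 3 j)))

      c : ℕ → ℤ
      c k = + 21 * power 5 k + (ℤ.- + 30 * power 4 k + (+ 10 * power 3 k + ℤ.- + 1 * power 1 k))

    convolution-odd : ⟦ + 24 ⟧ ⊛ (moment (oddOnly (power 1)) ⊛ moment (oddOnly (power 1)))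
        ⊕ ⟦ + 2 ⟧ ⊛ moment (oddOnly (power 1)) ≈
      ⟦ + 2 ⟧ ⊛ moment (power 3) ⊕ moment (evenOnly (power 3))
    convolution-odd = begin
      ⟦ + 24 ⟧ ⊛ (o ⊛ o) ⊕ ⟦ + 2 ⟧ ⊛ o
        ≈⟨ +-congʳ (+-identityʳ _) ⟨
      (⟦ + 24 ⟧ ⊛ (o ⊛ o) ⊕ 0#) ⊕ ⟦ + 2 ⟧ ⊛ o
        ≈⟨ +-congʳ (+-cong (*-congˡ (sym (square-product _ _))) (sym moment₂≈0)) ⟩
      (⟦ + 24 ⟧ ⊛ square (λ i j → ⟦ f i j ⟧) ⊕ moment₂ (λ m → + 6 * (g m m - + 4 * f m m))) ⊕ ⟦ + 2 ⟧ ⊛ o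
        ≈⟨ +-congʳ (liouvilleℤ (+ 6) (+ 4) f g c
             (λ i j → ℤ.*-comm (oddOnly (power 1) i) _)
             (λ i j → parityWeight-sym (oddPart i) (oddPart j) _ _)
             (λ i j → ≡.subst (λ p → parityWeight (oddPart i) p (+ suc i) (+ suc (suc (i ℕ.+ j))) ≡
                 g i j + + 4 * (oddOnly (power 1) i * (power 1 (suc (i ℕ.+ j)) when p)))
               (≡.sym (oddPart-+ i j)) (parityWeight-shift (oddPart i) (oddPart j) i j))
             ≡.refl 6∑parityWeight) ⟩
      moment c ⊕ ⟦ + 2 ⟧ ⊛ o
        ≈⟨ +-congʳ (trans (moment-+ _ _) (+-cong (moment-* _ _) (trans (moment-+ _ _) (+-congˡ (moment-* _ _))))) ⟩
      (⟦ + 2 ⟧ ⊛ moment (power 3) ⊕ (moment (evenOnly (power 3)) ⊕ ⟦ ℤ.- + 2 ⟧ ⊛ o)) ⊕ ⟦ + 2 ⟧ ⊛ o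
        ≈⟨ solve 3 (λ a b o → (a :+ (b :+ con (ℤ.- + 2) :* o)) :+ con (+ 2) :* o := a :+ b) refl _ _ _ ⟩
      ⟦ + 2 ⟧ ⊛ moment (power 3) ⊕ moment (evenOnly (power 3)) ∎
      where
      o = moment (oddOnly (power 1))

      f g : ℕ → ℕ → ℤ
      f i j = oddOnly (power 1) i * oddOnly (power 1) j
      g i j = parityWeight (oddPart i) (oddPart j) (+ suc i) (+ suc j)

      c : ℕ → ℤ
      c k = + 2 * power 3 k + (evenOnly (power 3) k + ℤ.- + 2 * oddOnly (power 1) k)

      moment₂≈0 : moment₂ (λ m → + 6 * (g m m - + 4 * f m m)) ≈ 0#
      moment₂≈0 = begin
        moment₂ (λ m → + 6 * (g m m - + 4 * f m m))
          ≈⟨ moment₂-cong (λ m → ≡.cong (_*_ (+ 6)) (parityWeight-diagonal (oddPart m) (+ suc m))) ⟩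
        moment₂ (λ m → + 0)
          ≈⟨ ∑-zero N (λ m → trans (*-congʳ 0-homo) (zeroˡ _)) ⟩
        0# ∎

    moment-oddOnly-evenOnly : ∀ u → moment u ≈ moment (oddOnly u) ⊕ moment (evenOnly u)
    moment-oddOnly-evenOnly u =
      trans (moment-cong λ m → split (u m) (oddPart m)) (moment-+ _ _)
      where
      split : ∀ a o → a ≡ (a when o) + (a when not o)
      split a true  = ≡.sym (ℤ.+-identityʳ a)
      split a false = ≡.sym (ℤ.+-identityˡ a)

    -- Doubling the range adds only zeros and lets the indices pair up as 2i, 2i + 1; the second
    -- stands for the even part 2i + 2.
    moment-evenOnly : ∀ u → moment (evenOnly u) ≈
                      ∑ N (λ i → ⟦ u (suc (i ℕ.+ i)) ⟧ ⊛ x (suc (i ℕ.+ i)))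
    moment-evenOnly u = begin
      ∑ N h                                       ≈⟨ ∑-extend h (ℕ.m≤m+n N N) (λ i N≤i →
                                                       trans (*-congˡ (x-vanishes i N≤i)) (zeroʳ _)) ⟨
      ∑ (N ℕ.+ N) h                               ≈⟨ ∑-pairs N h ⟩
      ∑ N (λ i → h (i ℕ.+ i) ⊕ h (suc (i ℕ.+ i))) ≈⟨ ∑-cong N pair ⟩
      ∑ N (λ i → ⟦ u (suc (i ℕ.+ i)) ⟧ ⊛ x (suc (i ℕ.+ i))) ∎
      where
      h : ℕ → Carrier
      h i = ⟦ evenOnly u i ⟧ ⊛ x i

      even : ∀ i → oddPart (suc (i ℕ.+ i)) ≡ false
      even i = ≡.trans (oddPart-+ i i) (xor-same (oddPart i))

      pair : ∀ i → h (i ℕ.+ i) ⊕ h (suc (i ℕ.+ i)) ≈ ⟦ u (suc (i ℕ.+ i)) ⟧ ⊛ x (suc (i ℕ.+ i))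
      pair i with oddPart (i ℕ.+ i) | even i
      ... | true | _ = trans (+-congʳ (trans (*-congʳ 0-homo) (zeroˡ _))) (+-identityˡ _)

    -- `κ` is 1 for the series X_a and 2 for X_2a, whose moments are still weighted by a.
    D-moment : ∀ {D} → IsDerivation D → ∀ κ → (∀ i → D (x i) ≈ ⟦ κ * + suc i ⟧ ⊛ (x i ⊕ x i ⊛ x i)) →
      ∀ e → D (moment (power e)) ≈ ⟦ κ ⟧ ⊛ (moment (power (suc e)) ⊕ moment₂ (power (suc e)))
    D-moment {D} isD κ D-x e = begin
      D (moment (power e))
        ≈⟨ D-∑ N _ ⟩
      ∑ N (λ m → D (⟦ power e m ⟧ ⊛ x m))
        ≈⟨ ∑-cong N (λ m → trans (D-ι* _ _) (trans (*-congˡ (trans (D-x m) (*-congʳ (*-homo _ _))))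
             (trans (solve 4 (λ p κ a x → p :* (κ :* a :* (x :+ x :* x)) :=
                                          κ :* ((a :* p) :* x :+ (a :* p) :* (x :* x))) refl _ _ _ _)
               (*-congˡ (+-cong (*-congʳ (sym (*-homo _ _))) (*-congʳ (sym (*-homo _ _)))))))) ⟩
      ∑ N (λ m → ⟦ κ ⟧ ⊛ (⟦ power (suc e) m ⟧ ⊛ x m ⊕ ⟦ power (suc e) m ⟧ ⊛ (x m ⊛ x m)))
        ≈⟨ trans (∑-*ˡ N _ _) (*-congˡ (∑-+ N _ _)) ⟩
      ⟦ κ ⟧ ⊛ (moment (power (suc e)) ⊕ moment₂ (power (suc e))) ∎
      where open IsDerivation isD

  -- The overpartition series and its derivatives.

  module OverpartitionSeries
    (D : Carrier → Carrier) (isDerivation : IsDerivation D)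
    (x : ℕ → Carrier)
    (x-* : ∀ i j → x i ⊛ x j ≈ x (suc (i ℕ.+ j)) ⊛ (1# ⊕ x i ⊕ x j))
    (N : ℕ) (x-vanishes : ∀ i → N ≤ i → x i ≈ 0#)
    (D-x : ∀ i → D (x i) ≈ ⟦ + suc i ⟧ ⊛ (x i ⊕ x i ⊛ x i))
    (count weight : ℕ → Carrier)
    (count-zero  : count 0 ≈ 1#)
    (count-suc   : ∀ n → count (suc n) ≈ count n ⊕ ⟦ + 2 ⟧ ⊛ (x n ⊛ count n))
    (weight-zero : weight 0 ≈ 0#)
    (weight-suc  : ∀ n → weight (suc n) ≈
      weight n ⊕ ⟦ + 2 ⟧ ⊛ (x n ⊛ weight n) ⊕ ⟦ + suc n ⟧ ⊛ (x n ⊛ count n))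
    where

    open IsDerivation isDerivation

    -- Reduces a goal to a polynomial identity: its two sides differ by a cofactor `k` times a known
    -- equation.
    combine : ∀ {l r a b} k → a ≈ b → l ⊖ r ≈ k ⊛ (a ⊖ b) → l ≈ r
    combine k a≈b eq = x∙y⁻¹≈ε⇒x≈y _ _ (trans eq (trans (*-congˡ (≈⇒-≈0 a≈b)) (zeroʳ k)))

    module _ where

      open Solver 0 0-homo using (solve; con; :-_; _:+_; _:*_; _:-_; _:=_)

      -- This is X_2a: index 2i + 1 stands for the part 2(i + 1).
      x′ : ℕ → Carrier
      x′ i = x (suc (i ℕ.+ i))

      x² : ∀ i → x i ⊛ x i ≈ x′ i ⊛ (⟦ + 1 ⟧ ⊕ ⟦ + 2 ⟧ ⊛ x i)
      x² i = trans (x-* i i) (*-congˡ (trans (+-congʳ (+-congʳ (sym 1-homo)))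
        (solve 1 (λ x → con (+ 1) :+ x :+ x := con (+ 1) :+ con (+ 2) :* x) refl _)))

      x′-* : ∀ i j → x′ i ⊛ x′ j ≈ x′ (suc (i ℕ.+ j)) ⊛ (1# ⊕ x′ i ⊕ x′ j)
      x′-* i j = trans (x-* _ _) (*-congʳ (reflexive (≡.cong (x ∘ suc) index)))
        where
        index : suc ((i ℕ.+ i) ℕ.+ suc (j ℕ.+ j)) ≡ suc (i ℕ.+ j) ℕ.+ suc (i ℕ.+ j)
        index = ℕS.solve 2 (λ i j → ℕS.con 1 ℕS.:+ ((i ℕS.:+ i) ℕS.:+ (ℕS.con 1 ℕS.:+ (j ℕS.:+ j))) ℕS.:=
          (ℕS.con 1 ℕS.:+ (i ℕS.:+ j)) ℕS.:+ (ℕS.con 1 ℕS.:+ (i ℕS.:+ j))) ≡.refl i j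

      x′-vanishes : ∀ i → N ≤ i → x′ i ≈ 0#
      x′-vanishes i N≤i = x-vanishes _ (ℕ.m≤n⇒m≤1+n (ℕ.≤-trans N≤i (ℕ.m≤m+n i i)))

      D-x′ : ∀ i → D (x′ i) ≈ ⟦ + 2 * + suc i ⟧ ⊛ (x′ i ⊕ x′ i ⊛ x′ i)
      D-x′ i = trans (D-x _) (*-congʳ (reflexive (≡.cong (⟦_⟧ ∘ +_)
        (ℕS.solve 1 (λ i → ℕS.con 2 ℕS.:+ (i ℕS.:+ i) ℕS.:= ℕS.con 2 ℕS.:* (ℕS.con 1 ℕS.:+ i)) ≡.refl i))))

      module L  = Lambert x x-* N x-vanishes
      module L′ = Lambert x′ x′-* N x′-vanishes

      s t s₃ t₃ o : Carrier
      s  = L.moment (power 1)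
      t  = L′.moment (power 1)
      s₃ = L.moment (power 3)
      t₃ = L′.moment (power 3)
      o  = s ⊖ ⟦ + 2 ⟧ ⊛ t

      D-1x : ∀ i → D (x i) ≈ ⟦ + 1 * + suc i ⟧ ⊛ (x i ⊕ x i ⊛ x i)
      D-1x i = trans (D-x i) (*-congʳ (reflexive (≡.cong ⟦_⟧ (≡.sym (ℤ.*-identityˡ (+ suc i))))))

      Ds : ⟦ + 12 ⟧ ⊛ (s ⊛ s) ⊕ ⟦ + 6 ⟧ ⊛ D s ≈ ⟦ + 5 ⟧ ⊛ s₃ ⊕ s
      Ds = trans
        (+-congˡ (*-congˡ (trans (L.D-moment isDerivation (+ 1) D-1x 1) (trans (*-congʳ 1-homo) (*-identityˡ _)))))
        L.convolution₁₁

      Dt : ⟦ + 12 ⟧ ⊛ (t ⊛ t) ⊕ ⟦ + 3 ⟧ ⊛ D t ≈ ⟦ + 5 ⟧ ⊛ t₃ ⊕ t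
      Dt = trans
        (+-congˡ (trans (*-congˡ (L′.D-moment isDerivation (+ 2) D-x′ 1))
          (solve 1 (λ y → con (+ 3) :* (con (+ 2) :* y) := con (+ 6) :* y) refl _)))
        L′.convolution₁₁

      Ds₃ : ⟦ + 240 ⟧ ⊛ (s ⊛ s₃) ⊕ ⟦ + 30 ⟧ ⊛ D s₃ ⊕ s ≈
            ⟦ + 21 ⟧ ⊛ L.moment (power 5) ⊕ ⟦ + 10 ⟧ ⊛ s₃
      Ds₃ = trans
        (+-congʳ (+-congˡ (*-congˡ (trans (L.D-moment isDerivation (+ 1) D-1x 3) (trans (*-congʳ 1-homo) (*-identityˡ _))))))
        L.convolution₁₃

      Dt₃ : ⟦ + 240 ⟧ ⊛ (t ⊛ t₃) ⊕ ⟦ + 15 ⟧ ⊛ D t₃ ⊕ t ≈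
            ⟦ + 21 ⟧ ⊛ L′.moment (power 5) ⊕ ⟦ + 10 ⟧ ⊛ t₃
      Dt₃ = trans
        (+-congʳ (+-congˡ (trans (*-congˡ (L′.D-moment isDerivation (+ 2) D-x′ 3))
          (solve 1 (λ y → con (+ 15) :* (con (+ 2) :* y) := con (+ 30) :* y) refl _))))
        L′.convolution₁₃

      moment-evenOnly-power : ∀ e a → (∀ i → power e (suc (i ℕ.+ i)) ≡ a * power e i) →
        L.moment (evenOnly (power e)) ≈ ⟦ a ⟧ ⊛ L′.moment (power e)
      moment-evenOnly-power e a double = begin
        L.moment (evenOnly (power e))
          ≈⟨ L.moment-evenOnly (power e) ⟩
        ∑ N (λ i → ⟦ power e (suc (i ℕ.+ i)) ⟧ ⊛ x′ i)
          ≈⟨ ∑-cong N (λ i → *-congʳ (reflexive (≡.cong ⟦_⟧ (double i)))) ⟩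
        L′.moment (λ i → a * power e i)
          ≈⟨ L′.moment-* a (power e) ⟩
        ⟦ a ⟧ ⊛ L′.moment (power e) ∎

      odd-moment : L.moment (oddOnly (power 1)) ≈ o
      odd-moment = combine (- ⟦ + 1 ⟧) eq
        (solve 3 (λ s o t → o :- (s :- con (+ 2) :* t) :=
          (:- con (+ 1)) :* (s :- (o :+ con (+ 2) :* t))) refl _ _ _)
        where
        eq : s ≈ L.moment (oddOnly (power 1)) ⊕ ⟦ + 2 ⟧ ⊛ t
        eq = trans (L.moment-oddOnly-evenOnly (power 1)) (+-congˡ
          (moment-evenOnly-power 1 (+ 2) power₁-double))

      o² : ⟦ + 24 ⟧ ⊛ (o ⊛ o) ⊕ ⟦ + 2 ⟧ ⊛ o ≈ ⟦ + 2 ⟧ ⊛ s₃ ⊕ ⟦ + 8 ⟧ ⊛ t₃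
      o² = begin
        ⟦ + 24 ⟧ ⊛ (o ⊛ o) ⊕ ⟦ + 2 ⟧ ⊛ o
          ≈⟨ +-cong (*-congˡ (*-cong odd-moment odd-moment)) (*-congˡ odd-moment) ⟨
        ⟦ + 24 ⟧ ⊛ (o′ ⊛ o′) ⊕ ⟦ + 2 ⟧ ⊛ o′
          ≈⟨ L.convolution-odd ⟩
        ⟦ + 2 ⟧ ⊛ s₃ ⊕ L.moment (evenOnly (power 3))
          ≈⟨ +-congˡ (moment-evenOnly-power 3 (+ 8) power₃-double) ⟩
        ⟦ + 2 ⟧ ⊛ s₃ ⊕ ⟦ + 8 ⟧ ⊛ t₃ ∎
        where o′ = L.moment (oddOnly (power 1))

      ∑-difference : ∀ a → ∑ N (λ i → ⟦ power 1 i ⟧ ⊛ (x i ⊖ ⟦ a ⟧ ⊛ x′ i)) ≈ s ⊖ ⟦ a ⟧ ⊛ t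
      ∑-difference a = begin
        ∑ N (λ i → ⟦ power 1 i ⟧ ⊛ (x i ⊖ ⟦ a ⟧ ⊛ x′ i))
          ≈⟨ ∑-cong N (λ i → solve 4 (λ p a x x′ → p :* (x :- a :* x′) :=
               p :* x :+ (:- a) :* (p :* x′)) refl _ _ _ _) ⟩
        ∑ N (λ i → ⟦ power 1 i ⟧ ⊛ x i ⊕ (- ⟦ a ⟧) ⊛ (⟦ power 1 i ⟧ ⊛ x′ i))
          ≈⟨ trans (∑-+ N _ _) (+-congˡ (∑-*ˡ N _ _)) ⟩
        s ⊕ (- ⟦ a ⟧) ⊛ t
          ≈⟨ solve 3 (λ s a t → s :+ (:- a) :* t := s :- a :* t) refl _ _ _ ⟩
        s ⊖ ⟦ a ⟧ ⊛ t ∎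

      +suc≈power : ∀ n → ⟦ + suc n ⟧ ≈ ⟦ power 1 n ⟧
      +suc≈power n = reflexive (≡.cong ⟦_⟧ (≡.sym (ℤ.*-identityʳ (+ suc n))))

      -- Logarithmic differentiation, one factor at a time: X_a² = X_2a (1 + 2X_a) implies a (X_a +
      -- X_a²) = a (X_a - X_2a)(1 + 2X_a).
      D-count : D (count N) ≈ ⟦ + 2 ⟧ ⊛ (s ⊖ t) ⊛ count N
      D-count = trans (go N) (*-congʳ (*-congˡ
        (trans (∑-difference (+ 1)) (+-congˡ (-‿cong (trans (*-congʳ 1-homo) (*-identityˡ t)))))))
        where
        w : ℕ → Carrier
        w n = ∑ n (λ i → ⟦ power 1 i ⟧ ⊛ (x i ⊖ ⟦ + 1 ⟧ ⊛ x′ i))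

        go : ∀ n → D (count n) ≈ ⟦ + 2 ⟧ ⊛ w n ⊛ count n
        go zero    = begin
          D (count 0)                    ≈⟨ trans (D-cong (trans count-zero (sym 1-homo))) (D-ι (+ 1)) ⟩
          0#                             ≈⟨ trans (*-congʳ (zeroʳ _)) (zeroˡ _) ⟨
          ⟦ + 2 ⟧ ⊛ 0# ⊛ count 0         ∎
        go (suc n) = begin
          D (count (suc n))
            ≈⟨ trans (D-cong (count-suc n)) (trans (D-+ _ _) (+-congˡ (trans (D-ι* _ _) (*-congˡ (D-* _ _))))) ⟩
          D c ⊕ ⟦ + 2 ⟧ ⊛ (D (x n) ⊛ c ⊕ x n ⊛ D c)
            ≈⟨ +-cong (go n) (*-congˡ (+-cong (*-congʳ (trans (D-x n) (*-congʳ (+suc≈power n)))) (*-congˡ (go n)))) ⟩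
          ⟦ + 2 ⟧ ⊛ w n ⊛ c ⊕ ⟦ + 2 ⟧ ⊛ (⟦ power 1 n ⟧ ⊛ (x n ⊕ x n ⊛ x n) ⊛ c ⊕ x n ⊛ (⟦ + 2 ⟧ ⊛ w n ⊛ c))
            ≈⟨ combine (- (⟦ + 2 ⟧ ⊛ ⟦ power 1 n ⟧ ⊛ c)) (x² n) (solve 5 (λ w c p x x′ →
                 (con (+ 2) :* w :* c :+ con (+ 2) :* (p :* (x :+ x :* x) :* c :+ x :* (con (+ 2) :* w :* c))) :-
                 con (+ 2) :* (w :+ p :* (x :- con (+ 1) :* x′)) :* (c :+ con (+ 2) :* (x :* c)) :=
                 (:- (con (+ 2) :* p :* c)) :* (x :* x :- x′ :* (con (+ 1) :+ con (+ 2) :* x)))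
                 refl (w n) c ⟦ power 1 n ⟧ (x n) (x′ n)) ⟩
          ⟦ + 2 ⟧ ⊛ w (suc n) ⊛ (c ⊕ ⟦ + 2 ⟧ ⊛ (x n ⊛ c))
            ≈⟨ *-congˡ (count-suc n) ⟨
          ⟦ + 2 ⟧ ⊛ w (suc n) ⊛ count (suc n) ∎
          where c = count n

      -- Overlining the part a replaces the factor 1 + 2X_a by X_a, weighted with a, and X_a = (X_a
      -- - 2X_2a)(1 + 2X_a).
      weight≈ : weight N ≈ o ⊛ count N
      weight≈ = trans (go N) (*-congʳ (∑-difference (+ 2)))
        where
        v : ℕ → Carrier
        v n = ∑ n (λ i → ⟦ power 1 i ⟧ ⊛ (x i ⊖ ⟦ + 2 ⟧ ⊛ x′ i))

        go : ∀ n → weight n ≈ v n ⊛ count n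
        go zero    = trans weight-zero (sym (zeroˡ _))
        go (suc n) = begin
          weight (suc n)
            ≈⟨ weight-suc n ⟩
          weight n ⊕ ⟦ + 2 ⟧ ⊛ (x n ⊛ weight n) ⊕ ⟦ + suc n ⟧ ⊛ (x n ⊛ c)
            ≈⟨ +-cong (+-cong (go n) (*-congˡ (*-congˡ (go n)))) (*-congʳ (+suc≈power n)) ⟩
          v n ⊛ c ⊕ ⟦ + 2 ⟧ ⊛ (x n ⊛ (v n ⊛ c)) ⊕ ⟦ power 1 n ⟧ ⊛ (x n ⊛ c)
            ≈⟨ combine (- (⟦ + 2 ⟧ ⊛ ⟦ power 1 n ⟧ ⊛ c)) (x² n) (solve 5 (λ v c p x x′ →
                 (v :* c :+ con (+ 2) :* (x :* (v :* c)) :+ p :* (x :* c)) :-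
                 (v :+ p :* (x :- con (+ 2) :* x′)) :* (c :+ con (+ 2) :* (x :* c)) :=
                 (:- (con (+ 2) :* p :* c)) :* (x :* x :- x′ :* (con (+ 1) :+ con (+ 2) :* x)))
                 refl (v n) c ⟦ power 1 n ⟧ (x n) (x′ n)) ⟩
          v (suc n) ⊛ (c ⊕ ⟦ + 2 ⟧ ⊛ (x n ⊛ c))
            ≈⟨ *-congˡ (count-suc n) ⟨
          v (suc n) ⊛ count (suc n) ∎
          where c = count n

    -- The claim modulo 5.

    module Mod5 (5≈0 : ⟦ + 5 ⟧ ≈ 0#) where

      open Solver 5 5≈0 using (Polynomial; con; var; :-_; _:+_; _:*_; _:-_; ⟦_⟧ₑ; prove-difference; ∂; ∂-correct)

      private
        S T C : Polynomial 3
        S = var zero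
        T = var (suc zero)
        C = var (suc (suc zero))

        -- `Ds` and `Dt` solved for the derivatives: modulo 5 the terms in s₃ and t₃ drop out, 6 is
        -- 1, and 3 has inverse 2.
        δ : Fin 3 → Polynomial 3
        δ zero             = S :+ con (+ 3) :* S :* S
        δ (suc zero)       = con (+ 2) :* T :+ T :* T
        δ (suc (suc zero)) = con (+ 2) :* (S :- T) :* C

        ρ : Vec Carrier 3
        ρ = s ∷ t ∷ count N ∷ []

        D-ρ : ∀ i → D (lookup ρ i) ≈ ⟦ δ i ⟧ₑ ρ
        D-ρ zero = combine ⟦ + 1 ⟧ Ds (let s₀ = var zero; s₁ = var (suc zero); s₃ = var (suc (suc zero)) in
          prove-difference (s ∷ D s ∷ L.moment (power 3) ∷ [])
            (s₁ :- (s₀ :+ con (+ 3) :* s₀ :* s₀))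
            (con (+ 1) :* ((con (+ 12) :* (s₀ :* s₀) :+ con (+ 6) :* s₁) :- (con (+ 5) :* s₃ :+ s₀))) refl)
        D-ρ (suc zero) = combine ⟦ + 2 ⟧ Dt (let t₀ = var zero; t₁ = var (suc zero); t₃ = var (suc (suc zero)) in
          prove-difference (t ∷ D t ∷ L′.moment (power 3) ∷ [])
            (t₁ :- (con (+ 2) :* t₀ :+ t₀ :* t₀))
            (con (+ 2) :* ((con (+ 12) :* (t₀ :* t₀) :+ con (+ 3) :* t₁) :- (con (+ 5) :* t₃ :+ t₀))) refl)
        D-ρ (suc (suc zero)) = D-count

        D-eval : ∀ e → D (⟦ e ⟧ₑ ρ) ≈ ⟦ ∂ δ e ⟧ₑ ρ
        D-eval = ∂-correct isDerivation δ ρ D-ρ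

        W : Polynomial 3
        W = (S :- con (+ 2) :* T) :* C

      mod5 : D (D (weight N)) ≈ D (D (count N)) ⊕ ⟦ + 2 ⟧ ⊛ D (count N)
      mod5 = begin
        D (D (weight N))           ≈⟨ D-cong (trans (D-cong weight≈) (D-eval W)) ⟩
        D (⟦ ∂ δ W ⟧ₑ ρ)           ≈⟨ D-eval (∂ δ W) ⟩
        ⟦ ∂ δ (∂ δ W) ⟧ₑ ρ
          ≈⟨ prove-difference ρ (∂ δ (∂ δ W)) (∂ δ (∂ δ C) :+ con (+ 2) :* ∂ δ C) refl ⟩
        ⟦ ∂ δ (∂ δ C) :+ con (+ 2) :* ∂ δ C ⟧ₑ ρ
          ≈⟨ +-cong (trans (D-cong (D-eval C)) (D-eval (∂ δ C))) (*-congˡ (D-eval C)) ⟨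
        D (D (count N)) ⊕ ⟦ + 2 ⟧ ⊛ D (count N) ∎

    -- The claim modulo 7.

    module Mod7 (7≈0 : ⟦ + 7 ⟧ ≈ 0#) where

      open Solver 7 7≈0 using (Polynomial; con; var; :-_; _:+_; _:*_; _:-_; ⟦_⟧ₑ; prove-difference; ∂; ∂-correct)

      private
        S T T₃ C O S₃ : Polynomial 4
        S  = var zero
        T  = var (suc zero)
        T₃ = var (suc (suc zero))
        C  = var (suc (suc (suc zero)))
        O  = S :- con (+ 2) :* T
        -- Half of `o²`, used to eliminate s₃ and keep t₃ as the only cubic moment.
        S₃ = con (+ 12) :* O :* O :+ O :- con (+ 4) :* T₃

        -- The identities solved modulo 7, where 6 is -1, the inverse of 3 is 5, 15 is 1, and the
        -- fifth moment has coefficient 21 and drops out.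
        δ : Fin 4 → Polynomial 4
        δ zero                   = con (+ 12) :* S :* S :- con (+ 5) :* S₃ :- S
        δ (suc zero)             = con (+ 5) :* (con (+ 5) :* T₃ :+ T :- con (+ 12) :* T :* T)
        δ (suc (suc zero))       = con (+ 10) :* T₃ :- T :- con (+ 240) :* T :* T₃
        δ (suc (suc (suc zero))) = con (+ 2) :* (S :- T) :* C

        ρ : Vec Carrier 4
        ρ = s ∷ t ∷ t₃ ∷ count N ∷ []

        s₃≈ : s₃ ≈ ⟦ S₃ ⟧ₑ ρ
        -- The cofactor 3 is -1/2 modulo 7: it turns the coefficient -2 of s₃ into 1.
        s₃≈ = combine ⟦ + 3 ⟧ o² (let v = var (suc (suc (suc zero))) in
          prove-difference (s ∷ t ∷ t₃ ∷ s₃ ∷ []) (v :- S₃)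
            (con (+ 3) :* ((con (+ 24) :* (O :* O) :+ con (+ 2) :* O) :- (con (+ 2) :* v :+ con (+ 8) :* T₃))) refl)

        D-ρ : ∀ i → D (lookup ρ i) ≈ ⟦ δ i ⟧ₑ ρ
        D-ρ zero = trans
          (combine (- ⟦ + 1 ⟧) Ds (let s₀ = var zero; s₁ = var (suc zero); s₃ = var (suc (suc zero)) in
            prove-difference (s ∷ D s ∷ L.moment (power 3) ∷ [])
              (s₁ :- (con (+ 12) :* s₀ :* s₀ :- con (+ 5) :* s₃ :- s₀))
              ((:- con (+ 1)) :* ((con (+ 12) :* (s₀ :* s₀) :+ con (+ 6) :* s₁) :- (con (+ 5) :* s₃ :+ s₀))) refl))
          (+-congʳ (+-congˡ (-‿cong (*-congˡ s₃≈))))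
        D-ρ (suc zero) = combine ⟦ + 5 ⟧ Dt (let t₀ = var zero; t₁ = var (suc zero); t₃ = var (suc (suc zero)) in
          prove-difference (t ∷ D t ∷ L′.moment (power 3) ∷ [])
            (t₁ :- con (+ 5) :* (con (+ 5) :* t₃ :+ t₀ :- con (+ 12) :* t₀ :* t₀))
            (con (+ 5) :* ((con (+ 12) :* (t₀ :* t₀) :+ con (+ 3) :* t₁) :- (con (+ 5) :* t₃ :+ t₀))) refl)
        D-ρ (suc (suc zero)) = combine ⟦ + 1 ⟧ Dt₃
          (let t = var zero; t₃ = var (suc zero); t₄ = var (suc (suc zero)); t₅ = var (suc (suc (suc zero))) in
          prove-difference (L′.moment (power 1) ∷ L′.moment (power 3) ∷ D (L′.moment (power 3)) ∷ L′.moment (power 5) ∷ [])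
            (t₄ :- (con (+ 10) :* t₃ :- t :- con (+ 240) :* t :* t₃))
            (con (+ 1) :* ((con (+ 240) :* (t :* t₃) :+ con (+ 15) :* t₄ :+ t) :-
              (con (+ 21) :* t₅ :+ con (+ 10) :* t₃))) refl)
        D-ρ (suc (suc (suc zero))) = D-count

        D-eval : ∀ e → D (⟦ e ⟧ₑ ρ) ≈ ⟦ ∂ δ e ⟧ₑ ρ
        D-eval = ∂-correct isDerivation δ ρ D-ρ

        Q W : Polynomial 4
        Q = ∂ δ S₃ :- (con (+ 40) :* S₃ :- con (+ 4) :* S :- con (+ 960) :* S :* S₃)
        W = O :* C

        -- The two expressions for the derivative of s₃ modulo 7 yield an algebraic relation.
        Q≈0 : ⟦ Q ⟧ₑ ρ ≈ 0#
        Q≈0 = ≈⇒-≈0 (begin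
          ⟦ ∂ δ S₃ ⟧ₑ ρ
            ≈⟨ trans (D-cong s₃≈) (D-eval S₃) ⟨
          D s₃
            -- Modulo 7 the coefficient 30 is 2, with inverse 4, and 21 times the fifth moment
            -- vanishes.
            ≈⟨ combine ⟦ + 4 ⟧ Ds₃
                 (let s = var zero; s₃ = var (suc zero); s₄ = var (suc (suc zero)); s₅ = var (suc (suc (suc zero))) in
                 prove-difference (L.moment (power 1) ∷ L.moment (power 3) ∷ D (L.moment (power 3)) ∷ L.moment (power 5) ∷ [])
                   (s₄ :- (con (+ 40) :* s₃ :- con (+ 4) :* s :- con (+ 960) :* s :* s₃))
                   (con (+ 4) :* ((con (+ 240) :* (s :* s₃) :+ con (+ 30) :* s₄ :+ s) :-
                     (con (+ 21) :* s₅ :+ con (+ 10) :* s₃))) refl) ⟩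
          ⟦ + 40 ⟧ ⊛ s₃ ⊖ ⟦ + 4 ⟧ ⊛ s ⊖ ⟦ + 960 ⟧ ⊛ s ⊛ s₃
            ≈⟨ +-cong (+-congʳ (*-congˡ s₃≈)) (-‿cong (*-congˡ s₃≈)) ⟩
          ⟦ con (+ 40) :* S₃ :- con (+ 4) :* S :- con (+ 960) :* S :* S₃ ⟧ₑ ρ ∎)

        ∂Q≈0 : ⟦ ∂ δ Q ⟧ₑ ρ ≈ 0#
        ∂Q≈0 = trans (sym (D-eval Q)) (trans (D-cong Q≈0) D-0)

        ∂³ : Polynomial 4 → Polynomial 4
        ∂³ e = ∂ δ (∂ δ (∂ δ e))

        D³-eval : ∀ {y} e → y ≈ ⟦ e ⟧ₑ ρ → D (D (D y)) ≈ ⟦ ∂³ e ⟧ₑ ρ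
        D³-eval e y≈e = trans
          (D-cong (trans (D-cong (trans (D-cong y≈e) (D-eval e))) (D-eval (∂ δ e))))
          (D-eval (∂ δ (∂ δ e)))

      mod7 : ⟦ + 4 ⟧ ⊛ D (D (D (weight N))) ≈ D (D (D (count N))) ⊕ D (count N)
      mod7 = begin
        ⟦ + 4 ⟧ ⊛ D (D (D (weight N)))
          ≈⟨ *-congˡ (D³-eval W weight≈) ⟩
        ⟦ con (+ 4) :* ∂³ W ⟧ₑ ρ
          ≈⟨ prove-difference ρ (con (+ 4) :* ∂³ W)
               ((∂³ C :+ ∂ δ C) :+ (k :* Q :- ∂ δ Q) :* C) refl ⟩
        ⟦ ∂³ C :+ ∂ δ C ⟧ₑ ρ ⊕ (⟦ k ⟧ₑ ρ ⊛ ⟦ Q ⟧ₑ ρ ⊖ ⟦ ∂ δ Q ⟧ₑ ρ) ⊛ count N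
          ≈⟨ +-congˡ (trans (*-congʳ (≈⇒-≈0 (trans (trans (*-congˡ Q≈0) (zeroʳ _)) (sym ∂Q≈0)))) (zeroˡ _)) ⟩
        ⟦ ∂³ C :+ ∂ δ C ⟧ₑ ρ ⊕ 0#
          ≈⟨ +-identityʳ _ ⟩
        ⟦ ∂³ C :+ ∂ δ C ⟧ₑ ρ
          ≈⟨ +-cong (D³-eval C refl) (D-eval C) ⟨
        D (D (D (count N))) ⊕ D (count N) ∎
        where
        -- A certificate: with this cofactor the defect of the claim equals (k Q - ∂Q) P, where Q
        -- and ∂Q both vanish.
        k : Polynomial 4
        k = con (+ 4) :* (S :- T) :+ O :+ con (+ 5)

  -- Geometric series without division.

  module Geometric
    (q x : ℕ → Carrier) (x≈ : ∀ i → x i ≈ q i ⊛ (1# ⊕ x i))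
    where

    open Solver 0 0-homo using (solve; con; _:+_; _:*_; _:-_; _:=_)

    private
      g : ℕ → Carrier
      g i = ⟦ + 1 ⟧ ⊕ x i

      x≈q*g : ∀ i → x i ≈ q i ⊛ g i
      x≈q*g i = trans (x≈ i) (*-congˡ (+-congʳ (sym 1-homo)))

      -- `g i` inverts 1 - q: indeed (1 + x)(1 - q) = 1 + x - q (1 + x) = 1.
      divide : ∀ i {y z} → y ⊖ q i ⊛ y ≈ z → y ≈ g i ⊛ z
      divide i {y} {z} eq = begin
        y                                 ≈⟨ solve 2 (λ x y → y := (con (+ 1) :+ x :- x) :* y) refl (x i) y ⟩
        (⟦ + 1 ⟧ ⊕ x i ⊖ x i) ⊛ y         ≈⟨ *-congʳ (+-congˡ (-‿cong (x≈q*g i))) ⟩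
        (g i ⊖ q i ⊛ g i) ⊛ y             ≈⟨ solve 3 (λ g q y → (g :- q :* g) :* y := g :* (y :- q :* y)) refl _ _ _ ⟩
        g i ⊛ (y ⊖ q i ⊛ y)               ≈⟨ *-congˡ eq ⟩
        g i ⊛ z                           ∎

    -- The equation says (1 - q) y = q f. It serves to recognise the sums coming from the
    -- enumeration as products with X_a.
    geometric-unique : ∀ i {f y} → y ≈ q i ⊛ (f ⊕ y) → y ≈ x i ⊛ f
    geometric-unique i {f} {y} eq = begin
      y                 ≈⟨ divide i (trans (+-congʳ eq)
                             (solve 3 (λ q f y → q :* (f :+ y) :- q :* y := q :* f) refl _ _ _)) ⟩
      g i ⊛ (q i ⊛ f)   ≈⟨ solve 3 (λ g q f → g :* (q :* f) := (q :* g) :* f) refl _ _ _ ⟩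
      (q i ⊛ g i) ⊛ f   ≈⟨ *-congʳ (x≈q*g i) ⟨
      x i ⊛ f           ∎

    -- With g = 1 + x one has x_i x_j = q_k g_i g_j, hence 1 + x_i + x_j = g_i g_j - x_i x_j = (1 -
    -- q_k) g_i g_j. It remains to use x_k (1 - q_k) = q_k.
    geometric-* : (∀ i j → q i ⊛ q j ≈ q (suc (i ℕ.+ j))) →
      ∀ i j → x i ⊛ x j ≈ x (suc (i ℕ.+ j)) ⊛ (1# ⊕ x i ⊕ x j)
    geometric-* q-* i j = sym (begin
      x k ⊛ (1# ⊕ x i ⊕ x j)
        ≈⟨ *-congˡ (+-congʳ (+-congʳ (sym 1-homo))) ⟩
      x k ⊛ (⟦ + 1 ⟧ ⊕ x i ⊕ x j)
        ≈⟨ solve 3 (λ xk xi xj → xk :* (con (+ 1) :+ xi :+ xj) :=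
             xk :* ((con (+ 1) :+ xi) :* (con (+ 1) :+ xj) :- xi :* xj)) refl _ _ _ ⟩
      x k ⊛ (g i ⊛ g j ⊖ x i ⊛ x j)
        ≈⟨ *-congˡ (+-congˡ (-‿cong x*x)) ⟩
      x k ⊛ (g i ⊛ g j ⊖ q k ⊛ (g i ⊛ g j))
        ≈⟨ solve 3 (λ xk q G → xk :* (G :- q :* G) := (xk :- q :* xk) :* G) refl _ _ _ ⟩
      (x k ⊖ q k ⊛ x k) ⊛ (g i ⊛ g j)
        ≈⟨ *-congʳ (trans (+-congʳ (x≈q*g k))
             (solve 2 (λ q x → q :* (con (+ 1) :+ x) :- q :* x := q) refl _ _)) ⟩
      q k ⊛ (g i ⊛ g j)
        ≈⟨ x*x ⟨
      x i ⊛ x j ∎)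
      where
      k = suc (i ℕ.+ j)

      x*x : x i ⊛ x j ≈ q k ⊛ (g i ⊛ g j)
      x*x = begin
        x i ⊛ x j                   ≈⟨ *-cong (x≈q*g i) (x≈q*g j) ⟩
        (q i ⊛ g i) ⊛ (q j ⊛ g j)   ≈⟨ solve 4 (λ a b c d → (a :* b) :* (c :* d) := (a :* c) :* (b :* d)) refl _ _ _ _ ⟩
        (q i ⊛ q j) ⊛ (g i ⊛ g j)   ≈⟨ *-congʳ (q-* i j) ⟩
        q k ⊛ (g i ⊛ g j)           ∎

    -- Differentiating x = q (1 + x) gives (1 - q) D x = (D q)(1 + x) = a x.
    D-geometric : ∀ {D} → IsDerivation D → (∀ i → D (q i) ≈ ⟦ + suc i ⟧ ⊛ q i) →
      ∀ i → D (x i) ≈ ⟦ + suc i ⟧ ⊛ (x i ⊕ x i ⊛ x i)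
    D-geometric {D} isD D-q i = begin
      D (x i)
        ≈⟨ divide i (begin
             D (x i) ⊖ q i ⊛ D (x i)
               ≈⟨ +-congʳ (trans (D-cong (x≈q*g i)) (trans (D-* _ _) (+-cong (*-congʳ (D-q i))
                    (*-congˡ (trans (D-+ _ _) (trans (+-congʳ (D-ι (+ 1))) (+-identityˡ _))))))) ⟩
             (⟦ + suc i ⟧ ⊛ q i ⊛ g i ⊕ q i ⊛ D (x i)) ⊖ q i ⊛ D (x i)
               ≈⟨ solve 4 (λ a q g y → (a :* q :* g :+ q :* y) :- q :* y := a :* (q :* g)) refl _ _ _ _ ⟩
             ⟦ + suc i ⟧ ⊛ (q i ⊛ g i)
               ≈⟨ *-congˡ (x≈q*g i) ⟨
             ⟦ + suc i ⟧ ⊛ x i ∎) ⟩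
      g i ⊛ (⟦ + suc i ⟧ ⊛ x i)
        ≈⟨ solve 2 (λ a x → (con (+ 1) :+ x) :* (a :* x) := a :* (x :+ x :* x)) refl _ _ ⟩
      ⟦ + suc i ⟧ ⊛ (x i ⊕ x i ⊛ x i) ∎
      where open IsDerivation isD

-- Arithmetic of congruences.

module _ where

  open ℤS using (solve; con; :-_; _:+_; _:*_; _:-_; _:=_)

  mod⁺ : ∀ {p a b} q → a ≡ b + q * + p → a ≡ b [mod p ]
  mod⁺ {p} {b = b} q ≡.refl = ℤ.∣⇒∣ᵤ (ℤ.divides q (solve 2 (λ b y → b :+ y :- b := y) ≡.refl b (q * + p)))

  mod⁻ : ∀ {p a b} → a ≡ b [mod p ] → ∃ λ q → a ≡ b + q * + p
  mod⁻ {p} {a} {b} p∣ with ℤ.divides q eq ← ℤ.∣ᵤ⇒∣ {+ p} {a - b} p∣ =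
    q , ≡.trans (solve 2 (λ a b → a := b :+ (a :- b)) ≡.refl a b) (≡.cong (_+_ b) eq)

  mod-reflexive : ∀ {p a b} → a ≡ b → a ≡ b [mod p ]
  mod-reflexive {p} {a} ≡.refl = mod⁺ {p} (+ 0) (≡.sym (ℤ.+-identityʳ a))

  mod-+ : ∀ {p a b c d} → a ≡ b [mod p ] → c ≡ d [mod p ] → a + c ≡ b + d [mod p ]
  mod-+ {p} {a} {b} {c} {d} a≡b c≡d
    with q , ≡.refl ← mod⁻ {p} {a} {b} a≡b | q′ , ≡.refl ← mod⁻ {p} {c} {d} c≡d =
    mod⁺ {p} (q + q′) (solve 5 (λ b d q q′ p → b :+ q :* p :+ (d :+ q′ :* p) :=
      b :+ d :+ (q :+ q′) :* p) ≡.refl b d q q′ (+ p))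

  mod-* : ∀ {p a b c d} → a ≡ b [mod p ] → c ≡ d [mod p ] → a * c ≡ b * d [mod p ]
  mod-* {p} {a} {b} {c} {d} a≡b c≡d
    with q , ≡.refl ← mod⁻ {p} {a} {b} a≡b | q′ , ≡.refl ← mod⁻ {p} {c} {d} c≡d =
    mod⁺ {p} (b * q′ + q * (d + q′ * + p)) (solve 5 (λ b d q q′ p →
      (b :+ q :* p) :* (d :+ q′ :* p) :=
      b :* d :+ (b :* q′ :+ q :* (d :+ q′ :* p)) :* p) ≡.refl b d q q′ (+ p))

  mod-neg : ∀ {p a b} → a ≡ b [mod p ] → ℤ.- a ≡ ℤ.- b [mod p ]
  mod-neg {p} {a} {b} a≡b with q , ≡.refl ← mod⁻ {p} {a} {b} a≡b =
    mod⁺ {p} (ℤ.- q) (solve 3 (λ b q p → :- (b :+ q :* p) :=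
      :- b :+ (:- q) :* p) ≡.refl b q (+ p))

  mod-sym : ∀ {p a b} → a ≡ b [mod p ] → b ≡ a [mod p ]
  mod-sym {p} {a} {b} a≡b with q , ≡.refl ← mod⁻ {p} {a} {b} a≡b =
    mod⁺ {p} (ℤ.- q) (solve 3 (λ b q p → b := b :+ q :* p :+ (:- q) :* p) ≡.refl b q (+ p))

  mod-trans : ∀ {p a b c} → a ≡ b [mod p ] → b ≡ c [mod p ] → a ≡ c [mod p ]
  mod-trans {p} {a} {b} {c} a≡b b≡c
    with q , ≡.refl ← mod⁻ {p} {a} {b} a≡b with q′ , ≡.refl ← mod⁻ {p} {b} {c} b≡c =
    mod⁺ {p} (q + q′) (solve 4 (λ c q q′ p → c :+ q′ :* p :+ q :* p :=
      c :+ (q :+ q′) :* p) ≡.refl c q q′ (+ p))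

-- Formal power series over the integers.

module Series where

  open ≡.≡-Reasoning
  open Sums ℤ.+-*-commutativeRing

  infixl 7 _⊛_

  _⊛_ : (ℕ → ℤ) → (ℕ → ℤ) → ℕ → ℤ
  (f ⊛ g) n = diag n λ i j → f i * g j

  const : ℤ → ℕ → ℤ
  const a zero    = a
  const a (suc n) = + 0

  ⊛-comm : ∀ f g n → (f ⊛ g) n ≡ (g ⊛ f) n
  ⊛-comm f g n =
    ≡.trans (diag-swap n λ i j → f i * g j) (diag-cong n λ i j _ → ℤ.*-comm (f j) (g i))

  ⊛-distribˡ : ∀ f g h n → (f ⊛ (λ m → g m + h m)) n ≡ (f ⊛ g) n + (f ⊛ h) n
  ⊛-distribˡ f g h n =
    ≡.trans (diag-cong n λ i j _ → ℤ.*-distribˡ-+ (f i) (g j) (h j)) (diag-+ n _ _)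

  ⊛-distribʳ : ∀ f g h n → ((λ m → g m + h m) ⊛ f) n ≡ (g ⊛ f) n + (h ⊛ f) n
  ⊛-distribʳ f g h n =
    ≡.trans (diag-cong n λ i j _ → ℤ.*-distribʳ-+ (f j) (g i) (h i)) (diag-+ n _ _)

  ⊛-scale : ∀ a f g n → ((λ m → a * f m) ⊛ g) n ≡ a * (f ⊛ g) n
  ⊛-scale a f g n =
    ≡.trans (diag-cong n λ i j _ → ℤ.*-assoc a (f i) (g j)) (diag-*ˡ n a _)

  ⊛-assoc : ∀ f g h n → ((f ⊛ g) ⊛ h) n ≡ (f ⊛ (g ⊛ h)) n
  ⊛-assoc f g h zero    = ℤ.*-assoc (f 0) (g 0) (h 0)
  ⊛-assoc f g h (suc n) = begin
    f 0 * g 0 * h (suc n) + ((λ m → f₀g m + (f₁ ⊛ g) m) ⊛ h) n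
      ≡⟨ ≡.cong₂ _+_ (ℤ.*-assoc (f 0) (g 0) (h (suc n))) (⊛-distribʳ h f₀g (f₁ ⊛ g) n) ⟩
    a + ((f₀g ⊛ h) n + ((f₁ ⊛ g) ⊛ h) n)
      ≡⟨ ≡.cong (_+_ a) (≡.cong₂ _+_ (⊛-scale (f 0) (g ∘ suc) h n) (⊛-assoc f₁ g h n)) ⟩
    a + (f 0 * ((g ∘ suc) ⊛ h) n + (f₁ ⊛ (g ⊛ h)) n)
      ≡⟨ ℤ.+-assoc a (f 0 * ((g ∘ suc) ⊛ h) n) ((f₁ ⊛ (g ⊛ h)) n) ⟨
    a + f 0 * ((g ∘ suc) ⊛ h) n + (f₁ ⊛ (g ⊛ h)) n
      ≡⟨ ≡.cong (_+ (f₁ ⊛ (g ⊛ h)) n) (ℤ.*-distribˡ-+ (f 0) (g 0 * h (suc n)) (((g ∘ suc) ⊛ h) n)) ⟨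
    f 0 * (g ⊛ h) (suc n) + (f₁ ⊛ (g ⊛ h)) n ∎
    where
    a = f 0 * (g 0 * h (suc n))

    f₁ f₀g : ℕ → ℤ
    f₁ m  = f (suc m)
    f₀g m = f 0 * g (suc m)

  zero-⊛ : ∀ f n → ((λ _ → + 0) ⊛ f) n ≡ + 0
  zero-⊛ f zero    = ≡.refl
  zero-⊛ f (suc n) = ≡.trans (ℤ.+-identityˡ _) (zero-⊛ f n)

  const-⊛ : ∀ a f n → (const a ⊛ f) n ≡ a * f n
  const-⊛ a f zero    = ≡.refl
  const-⊛ a f (suc n) = ≡.trans (≡.cong (_+_ (a * f (suc n))) (zero-⊛ f n)) (ℤ.+-identityʳ (a * f (suc n)))

  θ : (ℕ → ℤ) → ℕ → ℤ
  θ f n = + n * f n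

  θ-⊛ : ∀ f g n → θ (f ⊛ g) n ≡ (θ f ⊛ g) n + (f ⊛ θ g) n
  θ-⊛ f g n = begin
    + n * (f ⊛ g) n
      ≡⟨ diag-*ˡ n (+ n) _ ⟨
    diag n (λ i j → + n * (f i * g j))
      ≡⟨ diag-cong n (λ { i j ≡.refl → ℤS.solve 4 (λ i j x y →
           (i ℤS.:+ j) ℤS.:* (x ℤS.:* y) ℤS.:= i ℤS.:* x ℤS.:* y ℤS.:+ x ℤS.:* (j ℤS.:* y))
           ≡.refl (+ i) (+ j) (f i) (g j) }) ⟩
    diag n (λ i j → θ f i * g j + f i * θ g j)
      ≡⟨ diag-+ n _ _ ⟩
    (θ f ⊛ g) n + (f ⊛ θ g) n ∎

  shift : ℕ → (ℕ → ℤ) → ℕ → ℤ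
  shift zero    f n       = f n
  shift (suc k) f zero    = + 0
  shift (suc k) f (suc n) = shift k f n

  shift-cong : ∀ k {f g} → (∀ n → f n ≡ g n) → ∀ n → shift k f n ≡ shift k g n
  shift-cong zero    f≡g n       = f≡g n
  shift-cong (suc k) f≡g zero    = ≡.refl
  shift-cong (suc k) f≡g (suc n) = shift-cong k f≡g n

  shift-shift : ∀ j k f n → shift j (shift k f) n ≡ shift (j ℕ.+ k) f n
  shift-shift zero    k f n       = ≡.refl
  shift-shift (suc j) k f zero    = ≡.refl
  shift-shift (suc j) k f (suc n) = shift-shift j k f n

  shift-⊛ : ∀ k f g n → (shift k f ⊛ g) n ≡ shift k (f ⊛ g) n
  shift-⊛ zero    f g n       = ≡.refl
  shift-⊛ (suc k) f g zero    = ≡.refl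
  shift-⊛ (suc k) f g (suc n) = ≡.trans (ℤ.+-identityˡ _) (shift-⊛ k f g n)

  shift-below : ∀ k f {n} → n < k → shift k f n ≡ + 0
  shift-below (suc k) f {zero}  _         = ≡.refl
  shift-below (suc k) f {suc n} (s≤s n<k) = shift-below k f n<k

  shift-above : ∀ k f n → shift k f (k ℕ.+ n) ≡ f n
  shift-above zero    f n = ≡.refl
  shift-above (suc k) f n = shift-above k f n

  monomial : ℕ → ℕ → ℤ
  monomial k = shift k (const (+ 1))

  monomial-⊛ : ∀ k f n → (monomial k ⊛ f) n ≡ shift k f n
  monomial-⊛ k f n = ≡.trans (shift-⊛ k _ f n)
    (shift-cong k (λ m → ≡.trans (const-⊛ (+ 1) f m) (ℤ.*-identityˡ (f m))) n)

  θ-monomial : ∀ k n → θ (monomial k) n ≡ + k * monomial k n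
  θ-monomial = go 0
    where
    -- The offset `c` counts the shifts already undone: the recursion lowers `k` and `n`, but the
    -- factors refer to the original values.
    go : ∀ c k n → + (c ℕ.+ n) * monomial k n ≡ + (c ℕ.+ k) * monomial k n
    go c zero    zero    = ≡.refl
    go c zero    (suc n) = ≡.trans (ℤ.*-zeroʳ (+ (c ℕ.+ suc n))) (≡.sym (ℤ.*-zeroʳ (+ (c ℕ.+ 0))))
    go c (suc k) zero    = ≡.trans (ℤ.*-zeroʳ (+ (c ℕ.+ 0))) (≡.sym (ℤ.*-zeroʳ (+ (c ℕ.+ suc k))))
    go c (suc k) (suc n) rewrite ℕ.+-suc c n | ℕ.+-suc c k = go (suc c) k n

  -- The product of f and q^(k+1) / (1 - q^(k+1)), in the form in which bounded produces it.
  geometric : ℕ → (ℕ → ℤ) → ℕ → ℤ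
  geometric k f n = ∑ (n ℕ./ suc k) λ j → f (n ℕ.∸ suc j ℕ.* suc k)

  geometric-below : ∀ k f {n} → n < suc k → geometric k f n ≡ + 0
  geometric-below k f n<k rewrite m<n⇒m/n≡0 n<k = ≡.refl

  -- The term j = 0 is the value of `f` at n - (k + 1), and the other terms form the same sum for n
  -- - (k + 1). This is the fixed-point equation y = q^(k+1) (f + y).
  geometric-unfold : ∀ k f n → geometric k f n ≡ shift (suc k) (λ m → f m + geometric k f m) n
  geometric-unfold k f n with suc k ℕ.≤? n
  ... | no  k≰n = ≡.trans (geometric-below k f (ℕ.≰⇒> k≰n)) (≡.sym (shift-below (suc k) _ (ℕ.≰⇒> k≰n)))
  ... | yes k≤n = ≡.subst (λ n → geometric k f n ≡ shift (suc k) (λ m → f m + geometric k f m) n)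
    (ℕ.m+[n∸m]≡n k≤n) (begin
      ∑ ((suc k ℕ.+ m) ℕ./ suc k) (λ j → f ((suc k ℕ.+ m) ℕ.∸ suc j ℕ.* suc k))
        ≡⟨ ≡.cong (λ l → ∑ l (λ j → f ((suc k ℕ.+ m) ℕ.∸ suc j ℕ.* suc k))) quotient ⟩
      ∑ (suc (m ℕ./ suc k)) (λ j → f ((suc k ℕ.+ m) ℕ.∸ suc j ℕ.* suc k))
        ≡⟨ ∑-head (m ℕ./ suc k) _ ⟩
      f ((suc k ℕ.+ m) ℕ.∸ 1 ℕ.* suc k) + ∑ (m ℕ./ suc k) (λ j → f ((suc k ℕ.+ m) ℕ.∸ suc (suc j) ℕ.* suc k))
        ≡⟨ ≡.cong₂ _+_
             (≡.cong f (≡.trans (≡.cong ((suc k ℕ.+ m) ℕ.∸_) (ℕ.+-identityʳ (suc k))) (ℕ.m+n∸m≡n (suc k) m)))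
             (∑-cong (m ℕ./ suc k) λ j → ≡.cong f (ℕ.[m+n]∸[m+o]≡n∸o (suc k) m (suc j ℕ.* suc k))) ⟩
      f m + geometric k f m
        ≡⟨ shift-above (suc k) (λ m → f m + geometric k f m) m ⟨
      shift (suc k) (λ m → f m + geometric k f m) (suc k ℕ.+ m) ∎)
    where
    m = n ℕ.∸ suc k

    quotient : (suc k ℕ.+ m) ℕ./ suc k ≡ suc (m ℕ./ suc k)
    quotient = ≡.trans (+-distrib-/-∣ˡ m (ℕ.divides 1 (≡.sym (ℕ.+-identityʳ (suc k)))))
      (≡.cong (ℕ._+ m ℕ./ suc k) (n/n≡1 (suc k)))

-- The differential ring of truncated series.

-- Power series over ℤ, compared modulo p and q^(M+1).
module TruncatedSeries (p M : ℕ) where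

  open Series

  infix 4 _≈_

  record _≈_ (f g : ℕ → ℤ) : Set where
    constructor agree
    field
      coefficient : ∀ {n} → n ≤ M → f n ≡ g n [mod p ]

  open _≈_ public

  exactly : ∀ {f g} → (∀ n → f n ≡ g n) → f ≈ g
  exactly f≡g = agree λ {n} _ → mod-reflexive {p} (f≡g n)

  private
    diag-mod : ∀ n (h h′ : ℕ → ℕ → ℤ) → (∀ i j → i ℕ.+ j ≡ n → h i j ≡ h′ i j [mod p ]) →
      let open Sums ℤ.+-*-commutativeRing in diag n h ≡ diag n h′ [mod p ]
    diag-mod zero    h h′ eq = eq 0 0 ≡.refl
    diag-mod (suc n) h h′ eq = mod-+ {p} {h 0 (suc n)} {h′ 0 (suc n)} (eq 0 (suc n) ≡.refl)
      (diag-mod n (h ∘ suc) (h′ ∘ suc) λ i j i+j → eq (suc i) j (≡.cong suc i+j))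

  ring : CommutativeRing 0ℓ 0ℓ
  ring = record
    { Carrier = ℕ → ℤ
    ; _≈_ = _≈_
    ; _+_ = λ f g n → f n + g n
    ; _*_ = _⊛_
    ; -_  = λ f n → ℤ.- f n
    ; 0#  = λ _ → + 0
    ; 1#  = const (+ 1)
    ; isCommutativeRing = record
      { isRing = record
        { +-isAbelianGroup = record
          { isGroup = record
            { isMonoid = record
              { isSemigroup = record
                { isMagma = record
                  { isEquivalence = record
                    { refl  = exactly λ _ → ≡.refl
                    ; sym   = λ {f} {g} f≈g → agree λ {n} n≤M → mod-sym {p} {f n} {g n} (coefficient f≈g n≤M)
                    ; trans = λ {f} {g} {h} f≈g g≈h → agree λ {n} n≤M →
                        mod-trans {p} {f n} {g n} {h n} (coefficient f≈g n≤M) (coefficient g≈h n≤M)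
                    }
                  ; ∙-cong = λ {f} {f′} {g} {g′} f≈ g≈ → agree λ {n} n≤M →
                      mod-+ {p} {f n} {f′ n} {g n} {g′ n} (coefficient f≈ n≤M) (coefficient g≈ n≤M)
                  }
                ; assoc = λ f g h → exactly λ n → ℤ.+-assoc (f n) (g n) (h n)
                }
              ; identity = (λ f → exactly λ n → ℤ.+-identityˡ (f n)) , (λ f → exactly λ n → ℤ.+-identityʳ (f n))
              }
            ; inverse = (λ f → exactly λ n → ℤ.+-inverseˡ (f n)) , (λ f → exactly λ n → ℤ.+-inverseʳ (f n))
            ; ⁻¹-cong = λ {f} {g} f≈g → agree λ {n} n≤M → mod-neg {p} {f n} {g n} (coefficient f≈g n≤M)
            }
          ; comm = λ f g → exactly λ n → ℤ.+-comm (f n) (g n)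
          }
        ; *-cong = λ {f} {f′} {g} {g′} f≈ g≈ → agree λ {n} n≤M → diag-mod n _ _ λ { i j ≡.refl →
            mod-* {p} {f i} {f′ i} {g j} {g′ j} (coefficient f≈ (ℕ.m+n≤o⇒m≤o i n≤M))
              (coefficient g≈ (ℕ.m+n≤o⇒n≤o i n≤M)) }
        ; *-assoc = λ f g h → exactly (⊛-assoc f g h)
        ; *-identity = (λ f → exactly (one f)) , (λ f → exactly λ n → ≡.trans (⊛-comm f _ n) (one f n))
        ; distrib = (λ f g h → exactly (⊛-distribˡ f g h)) , (λ f g h → exactly (⊛-distribʳ f g h))
        }
      ; *-comm = λ f g → exactly (⊛-comm f g)
      }
    }
    where
    one : ∀ f n → (const (+ 1) ⊛ f) n ≡ f n
    one f n = ≡.trans (const-⊛ (+ 1) f n) (ℤ.*-identityˡ (f n))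

  constants : ℤ.+-*-rawRing -Raw-AlmostCommutative⟶ fromCommutativeRing ring
  constants = record
    { ⟦_⟧    = const
    ; +-homo = λ a b → exactly λ { zero → ≡.refl ; (suc n) → ≡.refl }
    ; *-homo = λ a b → exactly λ { zero → ≡.refl ; (suc n) →
        ≡.sym (≡.trans (const-⊛ a (const b) (suc n)) (ℤ.*-zeroʳ a)) }
    ; -‿homo = λ a → exactly λ { zero → ≡.refl ; (suc n) → ≡.refl }
    ; 0-homo = exactly λ { zero → ≡.refl ; (suc n) → ≡.refl }
    ; 1-homo = exactly λ _ → ≡.refl
    }

  p≈0 : const (+ p) ≈ λ _ → + 0
  p≈0 = agree λ
    { {zero}  _ → mod⁺ {p} {+ p} {+ 0} (+ 1) (≡.sym (≡.trans (ℤ.+-identityˡ _) (ℤ.*-identityˡ (+ p))))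
    ; {suc n} _ → mod-reflexive {p} {+ 0} ≡.refl }

  open IntegerCoefficients ring constants using (IsDerivation; module Geometric)

  -- The operator q d/dq acts on each coefficient separately and so respects both moduli; d/dq would
  -- lose a degree of precision.
  θ-isDerivation : IsDerivation θ
  θ-isDerivation = record
    { D-cong = λ {f} {g} f≈g → agree λ {n} n≤M →
        mod-* {p} {+ n} {+ n} {f n} {g n} (mod-reflexive {p} {+ n} ≡.refl) (coefficient f≈g n≤M)
    ; D-+    = λ f g → exactly λ n → ℤ.*-distribˡ-+ (+ n) (f n) (g n)
    ; D-*    = λ f g → exactly (θ-⊛ f g)
    ; D-ι    = λ a → exactly λ { zero → ≡.refl ; (suc n) → ℤ.*-zeroʳ (+ suc n) }
    }

  x : ℕ → ℕ → ℤ
  x k = geometric k (const (+ 1))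

  q : ℕ → ℕ → ℤ
  q k = monomial (suc k)

  private
    geometric≈ : ∀ k f → geometric k f ≈ q k ⊛ (λ n → f n + geometric k f n)
    geometric≈ k f = exactly λ n → ≡.trans (geometric-unfold k f n) (≡.sym (monomial-⊛ (suc k) _ n))

    q-* : ∀ i j → q i ⊛ q j ≈ q (suc (i ℕ.+ j))
    q-* i j = exactly λ n → ≡.trans (monomial-⊛ (suc i) (q j) n) (≡.trans (shift-shift (suc i) (suc j) _ n)
      (≡.cong (λ k → monomial k n) (ℕ.+-suc (suc i) j)))

    open Geometric q x (λ k → geometric≈ k (const (+ 1)))

  geometric≈x : ∀ k f → geometric k f ≈ x k ⊛ f
  geometric≈x k f = geometric-unique k (geometric≈ k f)

  x-* : ∀ i j → x i ⊛ x j ≈ x (suc (i ℕ.+ j)) ⊛ (λ n → const (+ 1) n + x i n + x j n)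
  x-* = geometric-* q-*

  x-vanishes : ∀ k → M ≤ k → x k ≈ λ _ → + 0
  x-vanishes k M≤k = agree λ n≤M →
    mod-reflexive {p} (geometric-below k (const (+ 1)) (s≤s (ℕ.≤-trans n≤M M≤k)))

  θ-x : ∀ k → θ (x k) ≈ const (+ suc k) ⊛ (λ n → x k n + (x k ⊛ x k) n)
  θ-x = D-geometric θ-isDerivation λ k → exactly λ n →
    ≡.trans (θ-monomial (suc k) n) (≡.sym (const-⊛ (+ suc k) (q k) n))

-- Generating functions of the enumeration.

module _ where

  open ≡.≡-Reasoning
  open Sums ℤ.+-*-commutativeRing using (∑; ∑-head; ∑-cong; ∑-+; ∑-*ˡ)
  open Series using (geometric)

  tally : (List Part → ℕ) → List (List Part) → ℤ
  tally w xs = + sum (map w xs)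

  tally-++ : ∀ w xs ys → tally w (xs ++ ys) ≡ tally w xs + tally w ys
  tally-++ w xs ys = ≡.cong +_ (≡.trans (≡.cong sum (map-++ w xs ys)) (sum-++ (map w xs) (map w ys)))

  tally-map : ∀ w f xs → tally w (map f xs) ≡ tally (w ∘ f) xs
  tally-map w f xs = ≡.cong (+_ ∘ sum) (≡.sym (map-∘ xs))

  tally-cong : ∀ {v w} xs → (∀ {x} → x ∈ xs → v x ≡ w x) → tally v xs ≡ tally w xs
  tally-cong xs v≡w = ≡.cong (+_ ∘ sum) (map-cong-local (All.tabulate v≡w))

  tally-+ : ∀ v w xs → tally (λ x → v x ℕ.+ w x) xs ≡ tally v xs + tally w xs
  tally-+ v w []       = ≡.refl
  tally-+ v w (x ∷ xs) = ≡.trans (≡.cong (_+_ (+ (v x ℕ.+ w x))) (tally-+ v w xs))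
    (ℤS.solve 4 (λ a b c d → a ℤS.:+ b ℤS.:+ (c ℤS.:+ d) ℤS.:= a ℤS.:+ c ℤS.:+ (b ℤS.:+ d))
      ≡.refl (+ v x) (+ w x) (tally v xs) (tally w xs))

  tally-const : ∀ c xs → tally (λ _ → c) xs ≡ + c * tally (λ _ → 1) xs
  tally-const c []       = ≡.sym (ℤ.*-zeroʳ (+ c))
  tally-const c (x ∷ xs) = ≡.trans (≡.cong (_+_ (+ c)) (tally-const c xs))
    (ℤS.solve 2 (λ c t → c ℤS.:+ c ℤS.:* t ℤS.:= c ℤS.:* (ℤS.con (+ 1) ℤS.:+ t)) ≡.refl (+ c) (tally (λ _ → 1) xs))

  tally-concatMap : ∀ w (F : ℕ → List (List Part)) m → tally w (concatMap F (upTo m)) ≡ ∑ m (λ j → tally w (F j))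
  tally-concatMap w F m = go m (λ j → j)
    where
    go : ∀ m (i : ℕ → ℕ) → tally w (concatMap F (applyUpTo i m)) ≡ ∑ m (λ j → tally w (F (i j)))
    go zero    i = ≡.refl
    go (suc m) i = begin
      tally w (F (i 0) ++ concatMap F (applyUpTo (i ∘ suc) m))
        ≡⟨ tally-++ w (F (i 0)) _ ⟩
      tally w (F (i 0)) + tally w (concatMap F (applyUpTo (i ∘ suc) m))
        ≡⟨ ≡.cong (_+_ (tally w (F (i 0)))) (go m (i ∘ suc)) ⟩
      tally w (F (i 0)) + ∑ m (λ j → tally w (F (i (suc j))))
        ≡⟨ ∑-head m (λ j → tally w (F (i j))) ⟨
      ∑ (suc m) (λ j → tally w (F (i j))) ∎

  count weight : ℕ → ℕ → ℤ
  count  m n = tally (λ _ → 1) (bounded m n)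
  weight m n = tally overlinedSum (bounded m n)

  layer : ℕ → ℕ → ℕ → List (List Part)
  layer m n j = starting m n false j ++ starting m n true j

  tally-bounded-suc : ∀ w m n → tally w (bounded (suc m) n) ≡
    tally w (bounded m n) + ∑ (n ℕ./ suc m) (λ j → tally w (layer m n j))
  tally-bounded-suc w m n = ≡.trans (tally-++ w (bounded m n) _)
    (≡.cong (_+_ (tally w (bounded m n))) (tally-concatMap w (layer m n) (n ℕ./ suc m)))

  -- Each positive multiplicity of the part m + 1 occurs plain and overlined: this is the factor 1 +
  -- 2X_{m+1}.
  count-suc : ∀ m n → count (suc m) n ≡ count m n + + 2 * geometric m (count m) n
  count-suc m n = ≡.trans (tally-bounded-suc (λ _ → 1) m n) (≡.cong (_+_ (count m n)) (begin
    ∑ (n ℕ./ suc m) (λ j → tally (λ _ → 1) (layer m n j))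
      ≡⟨ ∑-cong (n ℕ./ suc m) each ⟩
    ∑ (n ℕ./ suc m) (λ j → + 2 * count m (n ℕ.∸ suc j ℕ.* suc m))
      ≡⟨ ∑-*ˡ (n ℕ./ suc m) (+ 2) _ ⟩
    + 2 * geometric m (count m) n ∎))
    where
    each : ∀ j → tally (λ _ → 1) (layer m n j) ≡ + 2 * count m (n ℕ.∸ suc j ℕ.* suc m)
    each j = begin
      tally (λ _ → 1) (layer m n j)
        ≡⟨ tally-++ (λ _ → 1) (starting m n false j) _ ⟩
      tally (λ _ → 1) (starting m n false j) + tally (λ _ → 1) (starting m n true j)
        ≡⟨ ≡.cong₂ _+_ (tally-map _ _ rest) (tally-map _ _ rest) ⟩
      c + c
        ≡⟨ ℤS.solve 1 (λ c → c ℤS.:+ c ℤS.:= ℤS.con (+ 2) ℤS.:* c) ≡.refl c ⟩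
      + 2 * c ∎
      where
      rest = bounded m (n ℕ.∸ suc j ℕ.* suc m)
      c = tally (λ _ → 1) rest

  overlinedSum-++ : ∀ ps qs → overlinedSum (ps ++ qs) ≡ overlinedSum ps ℕ.+ overlinedSum qs
  overlinedSum-++ ps qs = ≡.trans (≡.cong sum (map-++ _ ps qs)) (sum-++ (map _ ps) _)

  overlinedSum-block : ∀ s b j qs →
    overlinedSum (block s b j ++ qs) ≡ (if b then s else 0) ℕ.+ overlinedSum qs
  overlinedSum-block s b j qs = begin
    overlinedSum (block s b j ++ qs)
      ≡⟨ overlinedSum-++ (block s b j) qs ⟩
    (if b then s else 0) ℕ.+ overlinedSum (replicate j (part s false)) ℕ.+ overlinedSum qs
      ≡⟨ ≡.cong (λ c → (if b then s else 0) ℕ.+ c ℕ.+ overlinedSum qs) (plain j) ⟩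
    (if b then s else 0) ℕ.+ 0 ℕ.+ overlinedSum qs
      ≡⟨ ≡.cong (ℕ._+ overlinedSum qs) (ℕ.+-identityʳ _) ⟩
    (if b then s else 0) ℕ.+ overlinedSum qs ∎
    where
    plain : ∀ j → overlinedSum (replicate j (part s false)) ≡ 0
    plain zero    = ≡.refl
    plain (suc j) = plain j

  -- Both versions of a block keep the weight of the remaining parts; the overlined one adds m + 1
  -- once for each remainder, hence the term in `count`.
  weight-suc : ∀ m n → weight (suc m) n ≡
    weight m n + + 2 * geometric m (weight m) n + + suc m * geometric m (count m) n
  weight-suc m n = ≡.trans (tally-bounded-suc overlinedSum m n)
    (≡.trans (≡.cong (_+_ (weight m n)) (begin
      ∑ (n ℕ./ suc m) (λ j → tally overlinedSum (layer m n j))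
        ≡⟨ ∑-cong (n ℕ./ suc m) each ⟩
      ∑ (n ℕ./ suc m) (λ j → + 2 * weight m (n ℕ.∸ suc j ℕ.* suc m) + + suc m * count m (n ℕ.∸ suc j ℕ.* suc m))
        ≡⟨ ∑-+ (n ℕ./ suc m) _ _ ⟩
      ∑ (n ℕ./ suc m) (λ j → + 2 * weight m (n ℕ.∸ suc j ℕ.* suc m)) +
      ∑ (n ℕ./ suc m) (λ j → + suc m * count m (n ℕ.∸ suc j ℕ.* suc m))
        ≡⟨ ≡.cong₂ _+_ (∑-*ˡ (n ℕ./ suc m) (+ 2) _) (∑-*ˡ (n ℕ./ suc m) (+ suc m) _) ⟩
      + 2 * geometric m (weight m) n + + suc m * geometric m (count m) n ∎))
    (≡.sym (ℤ.+-assoc (weight m n) (+ 2 * geometric m (weight m) n) (+ suc m * geometric m (count m) n))))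
    where
    starting-weight : ∀ b j → let rest = bounded m (n ℕ.∸ suc j ℕ.* suc m) in
      tally overlinedSum (starting m n b j) ≡
      + (if b then suc m else 0) * tally (λ _ → 1) rest + tally overlinedSum rest
    starting-weight b j = begin
      tally overlinedSum (starting m n b j)
        ≡⟨ tally-map overlinedSum _ rest ⟩
      tally (λ qs → overlinedSum (block (suc m) b j ++ qs)) rest
        ≡⟨ tally-cong rest (λ {qs} _ → overlinedSum-block (suc m) b j qs) ⟩
      tally (λ qs → (if b then suc m else 0) ℕ.+ overlinedSum qs) rest
        ≡⟨ tally-+ (λ _ → if b then suc m else 0) overlinedSum rest ⟩
      tally (λ _ → if b then suc m else 0) rest + tally overlinedSum rest
        ≡⟨ ≡.cong (_+ tally overlinedSum rest) (tally-const _ rest) ⟩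
      + (if b then suc m else 0) * tally (λ _ → 1) rest + tally overlinedSum rest ∎
      where rest = bounded m (n ℕ.∸ suc j ℕ.* suc m)

    each : ∀ j → tally overlinedSum (layer m n j) ≡
      + 2 * weight m (n ℕ.∸ suc j ℕ.* suc m) + + suc m * count m (n ℕ.∸ suc j ℕ.* suc m)
    each j = begin
      tally overlinedSum (layer m n j)
        ≡⟨ tally-++ overlinedSum (starting m n false j) _ ⟩
      tally overlinedSum (starting m n false j) + tally overlinedSum (starting m n true j)
        ≡⟨ ≡.cong₂ _+_ (starting-weight false j) (starting-weight true j) ⟩
      + 0 * c + w + (+ suc m * c + w)
        ≡⟨ ℤS.solve 3 (λ a c w → ℤS.con (+ 0) ℤS.:* c ℤS.:+ w ℤS.:+ (a ℤS.:* c ℤS.:+ w) ℤS.:=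
             ℤS.con (+ 2) ℤS.:* w ℤS.:+ a ℤS.:* c) ≡.refl (+ suc m) c w ⟩
      + 2 * w + + suc m * c ∎
      where
      c = count m (n ℕ.∸ suc j ℕ.* suc m)
      w = weight m (n ℕ.∸ suc j ℕ.* suc m)

  nonOverlinedSum+overlinedSum : ∀ ps → nonOverlinedSum ps ℕ.+ overlinedSum ps ≡ sum (map size ps)
  nonOverlinedSum+overlinedSum [] = ≡.refl
  nonOverlinedSum+overlinedSum (part s true ∷ ps) = ≡.trans
    (ℕS.solve 3 (λ s a b → a ℕS.:+ (s ℕS.:+ b) ℕS.:= s ℕS.:+ (a ℕS.:+ b)) ≡.refl s (nonOverlinedSum ps) (overlinedSum ps))
    (≡.cong (s ℕ.+_) (nonOverlinedSum+overlinedSum ps))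
  nonOverlinedSum+overlinedSum (part s false ∷ ps) = ≡.trans
    (ℕ.+-assoc s (nonOverlinedSum ps) (overlinedSum ps))
    (≡.cong (s ℕ.+_) (nonOverlinedSum+overlinedSum ps))

  -- Every listed overpartition has total n, by soundness of the enumeration, and contributes that
  -- total to the two sums together.
  nov+ov : ∀ n → + nov n + + ov n ≡ + n * count n n
  nov+ov n = begin
    + nov n + + ov n
      ≡⟨ tally-+ nonOverlinedSum overlinedSum (overpartitions n) ⟨
    tally (λ ps → nonOverlinedSum ps ℕ.+ overlinedSum ps) (overpartitions n)
      ≡⟨ tally-cong (overpartitions n) (λ {ps} ps∈ → ≡.trans (nonOverlinedSum+overlinedSum ps)
           (IsOverpartition.total (Equivalence.to ∈-overpartitions ps∈))) ⟩
    tally (λ _ → n) (overpartitions n)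
      ≡⟨ tally-const n (overpartitions n) ⟩
    + n * count n n ∎

-- The recurrences in the truncated ring.

module _ (p n : ℕ) where

  open TruncatedSeries p n
  open Series using (_⊛_; const; const-⊛; θ; geometric)
  open CommutativeRing ring using (trans; +-cong; *-cong) renaming (refl to ≈-refl)

  private
    count-zero≈ : count 0 ≈ const (+ 1)
    count-zero≈ = exactly λ { zero → ≡.refl ; (suc n) → ≡.refl }

    count-suc≈ : ∀ m → count (suc m) ≈ λ k → count m k + (const (+ 2) ⊛ (x m ⊛ count m)) k
    count-suc≈ m = trans
      (exactly λ k → ≡.trans (count-suc m k)
        (≡.cong (_+_ (count m k)) (≡.sym (const-⊛ (+ 2) (geometric m (count m)) k))))
      (+-cong (≈-refl {count m}) (*-cong (≈-refl {const (+ 2)}) (geometric≈x m (count m))))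

    weight-zero≈ : weight 0 ≈ λ _ → + 0
    weight-zero≈ = exactly λ { zero → ≡.refl ; (suc n) → ≡.refl }

    weight-suc≈ : ∀ m → weight (suc m) ≈ λ k → weight m k +
      (const (+ 2) ⊛ (x m ⊛ weight m)) k + (const (+ suc m) ⊛ (x m ⊛ count m)) k
    weight-suc≈ m = trans
      (exactly λ k → ≡.trans (weight-suc m k)
        (≡.cong₂ (λ a b → weight m k + a + b) (≡.sym (const-⊛ (+ 2) (geometric m (weight m)) k))
          (≡.sym (const-⊛ (+ suc m) (geometric m (count m)) k))))
      (+-cong (+-cong (≈-refl {weight m}) (*-cong (≈-refl {const (+ 2)}) (geometric≈x m (weight m))))
        (*-cong (≈-refl {const (+ suc m)}) (geometric≈x m (count m))))

  open IntegerCoefficients ring constants using (module OverpartitionSeries)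
  -- Truncation after q^n allows `N` = n: larger parts have vanishing series, and `overpartitions n`
  -- is `bounded n n`.
  open OverpartitionSeries θ θ-isDerivation x x-* n x-vanishes θ-x count weight
    count-zero≈ count-suc≈ weight-zero≈ weight-suc≈ public using (module Mod5; module Mod7)

-- From coefficients to the stated congruences.

module _ where

  open ≡.≡-Reasoning
  open ℤS using (solve; con; :-_; _:+_; _:*_; _:-_; _:^_; _:=_)

  -- Substituting N = nC - W compares (n² + 2n) C with (n² + 5n + 5) W. The surplus 5(n + 1) W is
  -- the second term of the quotient below.
  congruence-mod-5 : ∀ n {N W C} → N + W ≡ n * C →
    n * (n * W) ≡ n * (n * C) + + 2 * (n * C) [mod 5 ] →
    (n + + 2) * N ≡ (n ^ 2 + + 4 * n + + 3) * W [mod 5 ]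
  congruence-mod-5 n {N} {W} {C} N+W h
    with q , eq ← mod⁻ {5} {n * (n * W)} {n * (n * C) + + 2 * (n * C)} h =
    mod⁺ {5} (ℤ.- q - (n + + 1) * W) (begin
      (n + + 2) * N
        ≡⟨ solve 4 (λ n N W q → (n :+ con (+ 2)) :* N :=
             (n :+ con (+ 2)) :* (N :+ W) :- (n :+ con (+ 2)) :* W) ≡.refl n N W q ⟩
      (n + + 2) * (N + W) - (n + + 2) * W
        ≡⟨ ≡.cong (λ y → (n + + 2) * y - (n + + 2) * W) N+W ⟩
      (n + + 2) * (n * C) - (n + + 2) * W
        ≡⟨ solve 4 (λ n C W q → (n :+ con (+ 2)) :* (n :* C) :- (n :+ con (+ 2)) :* W :=
             n :* (n :* C) :+ con (+ 2) :* (n :* C) :+ q :* con (+ 5)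
             :- (n :+ con (+ 2)) :* W :- q :* con (+ 5)) ≡.refl n C W q ⟩
      n * (n * C) + + 2 * (n * C) + q * + 5 - (n + + 2) * W - q * + 5
        ≡⟨ ≡.cong (λ y → y - (n + + 2) * W - q * + 5) eq ⟨
      n * (n * W) - (n + + 2) * W - q * + 5
        ≡⟨ solve 3 (λ n W q → n :* (n :* W) :- (n :+ con (+ 2)) :* W :- q :* con (+ 5) :=
             (n :^ 2 :+ con (+ 4) :* n :+ con (+ 3)) :* W :+
             (:- q :- (n :+ con (+ 1)) :* W) :* con (+ 5)) ≡.refl n W q ⟩
      (n ^ 2 + + 4 * n + + 3) * W + (ℤ.- q - (n + + 1) * W) * + 5 ∎)

  -- Here (n² + 1) + (4n³ - n² - 1) is exactly 4n³, so the quotient comes from the hypothesis alone.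
  congruence-mod-7 : ∀ n {N W C} → N + W ≡ n * C →
    + 4 * (n * (n * (n * W))) ≡ n * (n * (n * C)) + n * C [mod 7 ] →
    (n ^ 2 + + 1) * N ≡ (+ 4 * n ^ 3 - n ^ 2 - + 1) * W [mod 7 ]
  congruence-mod-7 n {N} {W} {C} N+W h
    with q , eq ← mod⁻ {7} {+ 4 * (n * (n * (n * W)))} {n * (n * (n * C)) + n * C} h =
    mod⁺ {7} (ℤ.- q) (begin
      (n ^ 2 + + 1) * N
        ≡⟨ solve 3 (λ n N W → (n :^ 2 :+ con (+ 1)) :* N :=
             (n :^ 2 :+ con (+ 1)) :* (N :+ W) :- (n :^ 2 :+ con (+ 1)) :* W) ≡.refl n N W ⟩
      (n ^ 2 + + 1) * (N + W) - (n ^ 2 + + 1) * W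
        ≡⟨ ≡.cong (λ y → (n ^ 2 + + 1) * y - (n ^ 2 + + 1) * W) N+W ⟩
      (n ^ 2 + + 1) * (n * C) - (n ^ 2 + + 1) * W
        ≡⟨ solve 4 (λ n C W q → (n :^ 2 :+ con (+ 1)) :* (n :* C) :- (n :^ 2 :+ con (+ 1)) :* W :=
             n :* (n :* (n :* C)) :+ n :* C :+ q :* con (+ 7)
             :- (n :^ 2 :+ con (+ 1)) :* W :- q :* con (+ 7)) ≡.refl n C W q ⟩
      n * (n * (n * C)) + n * C + q * + 7 - (n ^ 2 + + 1) * W - q * + 7
        ≡⟨ ≡.cong (λ y → y - (n ^ 2 + + 1) * W - q * + 7) eq ⟨
      + 4 * (n * (n * (n * W))) - (n ^ 2 + + 1) * W - q * + 7
        ≡⟨ solve 3 (λ n W q → con (+ 4) :* (n :* (n :* (n :* W)))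
             :- (n :^ 2 :+ con (+ 1)) :* W :- q :* con (+ 7) :=
             (con (+ 4) :* n :^ 3 :- n :^ 2 :- con (+ 1)) :* W :+
             (:- q) :* con (+ 7)) ≡.refl n W q ⟩
      (+ 4 * n ^ 3 - n ^ 2 - + 1) * W + (ℤ.- q) * + 7 ∎)

-- The coefficient of q^n in `mod5`, the last one the truncation retains; each D has become a factor
-- n.
coefficient-mod-5 : ∀ n → + n * (+ n * + ov n) ≡ + n * (+ n * count n n) + + 2 * (+ n * count n n) [mod 5 ]
coefficient-mod-5 n = ≡.subst (λ y → + n * (+ n * + ov n) ≡ + n * (+ n * count n n) + y [mod 5 ])
  (Series.const-⊛ (+ 2) (Series.θ (count n)) n)
  (TruncatedSeries.coefficient (Mod5.mod5 5 n (TruncatedSeries.p≈0 5 n)) ℕ.≤-refl)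

coefficient-mod-7 : ∀ n → + 4 * (+ n * (+ n * (+ n * + ov n))) ≡ + n * (+ n * (+ n * count n n)) + + n * count n n [mod 7 ]
coefficient-mod-7 n = ≡.subst (λ y → y ≡ + n * (+ n * (+ n * count n n)) + + n * count n n [mod 7 ])
  (Series.const-⊛ (+ 4) (Series.θ (Series.θ (Series.θ (weight n)))) n)
  (TruncatedSeries.coefficient (Mod7.mod7 7 n (TruncatedSeries.p≈0 7 n)) ℕ.≤-refl)

theorem1p2 : (n : ℕ) →
    ( (+ n + + 2) * + nov n ≡ ((+ n) ^ 2 + + 4 * + n + + 3) * + ov n [mod 5 ] )
    × ( ((+ n) ^ 2 + + 1) * + nov n ≡ (+ 4 * (+ n) ^ 3 - (+ n) ^ 2 - + 1) * + ov n [mod 7 ] )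
theorem1p2 n =
  congruence-mod-5 (+ n) (nov+ov n) (coefficient-mod-5 n) ,
  congruence-mod-7 (+ n) (nov+ov n) (coefficient-mod-7 n)
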